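{- For every integer $n\ge 1$ the following identities hold: (i) $\tau(n) = n^4\sigma(n) - 24\sum_{m=1}^{n-1} (35 m^4 -52 m^3n + 18 m^2 n^2)\sigma(m)\sigma(n-m)$; (ii) $\tau(n) = n^4(7\sigma(n) - 6 \sigma_3(n)) - 168\sum_{m=1}^{n-1} (5 m^4 - 4 m^3n)\sigma(m)\sigma(n-m)$; (iii) $\tau(n) = n^4\sigma_3(n) - 168\sum_{m=1}^{n-1} (5 m^4 - 8 m^3n + 3 m^2n^2)\sigma(m)\sigma(n-m)$; (iv) $\tau(n) = \frac{n^4}{3}(7\sigma(n) -4\sigma_3(n)) - 56\sum_{m=1}^{n-1} (15 m^4 - 20 m^3n + 6m^2n^2)\sigma(m)\sigma(n-m)$.
   Context: $\tau(n)$ is Ramanujan's tau function, defined by $q\prod_{n\ge 1}(1-q^n)^{24} = \sum_{n\ge 1}\tau(n)q^n$. For $k\ge 1$, $\sigma_k(n)=\sum_{d\mid n} d^k$ (sum over positive divisors of $n$), and $\sigma(n)=\sigma_1(n)$. For $n=1$ the sum $\sum_{m=1}^{n-1}$ is empty and equals $0$. -}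

module Defs where

open import Data.Bool.Base using (if_then_else_)
open import Data.Fin.Base using (Fin; zero; suc; toℕ)
open import Data.Fin.Properties using (toℕ<n)
open import Data.Integer.Base using (ℤ; 0ℤ; 1ℤ; _+_; _*_; _-_)
open import Data.Integer.Properties using (+-*-semiring; *-identityˡ; *-zeroˡ; +-identityʳ)
open import Data.List.Base using (List; applyUpTo; filter; map)
open import Data.Nat.Base as ℕ using (ℕ; zero; suc; _∸_; _≤_; _<_; _≡ᵇ_; z≤n; s≤s)
open import Data.Nat.Divisibility using (_∣?_)
import Data.Nat.ListAction as ListAction
import Data.Nat.Properties as ℕ
open import Relation.Binary.PropositionalEquality
  using (_≡_; refl; sym; trans; cong; cong₂; module ≡-Reasoning)

open import Algebra.Properties.Semiring.Sum +-*-semiring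
  using (sum-syntax; sum⁺-syntax; sum-cong-≗; sum-replicate-zero)

divisors : ℕ → List ℕ
divisors n = filter (_∣? n) (applyUpTo suc n)

σ : ℕ → ℕ → ℕ
σ k n = ListAction.sum (map (ℕ._^ k) (divisors n))

-- The index i < n ∸ 1 stands for m = i + 1, so m runs over 1, …, n ∸ 1.
∑-from-1 : ℕ → (ℕ → ℤ) → ℤ
∑-from-1 n f = ∑[ i < n ∸ 1 ] f (suc (toℕ i))

infixl 10 ∑-from-1
syntax ∑-from-1 n (λ m → x) = ∑[1≤ m < n ] x

-- Formal power series over ℤ: a n is the coefficient of qⁿ.
PowerSeries : Set
PowerSeries = ℕ → ℤ

infixr 8 _^ₚ_
infixl 7 _⊛_
infixl 6 _⊖_

q^_ : ℕ → PowerSeries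
(q^ k) n = if k ≡ᵇ n then 1ℤ else 0ℤ

1ₚ : PowerSeries
1ₚ = q^ 0

_⊖_ : PowerSeries → PowerSeries → PowerSeries
(a ⊖ b) n = a n - b n

_⊛_ : PowerSeries → PowerSeries → PowerSeries
(a ⊛ b) n = ∑[ i ≤ n ] (a (toℕ i) * b (n ∸ toℕ i))

_^ₚ_ : PowerSeries → ℕ → PowerSeries
a ^ₚ zero  = 1ₚ
a ^ₚ suc m = a ⊛ a ^ₚ m

-- The finite product a 1 ⊛ ⋯ ⊛ a N.
∏≤ : ℕ → (ℕ → PowerSeries) → PowerSeries
∏≤ zero    a = 1ₚ
∏≤ (suc N) a = a (suc N) ⊛ ∏≤ N a

-- The infinite product over k ≥ 1, meaningful when a k ≡ 1 mod qᵏ for all k: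
-- the coefficient of qⁿ is then the same in all ∏≤ N a with N ≥ n
-- (see ∏≤-stable), and that common value is taken here.
∏∞ : (ℕ → PowerSeries) → PowerSeries
∏∞ a n = ∏≤ n a n

eulerFactor²⁴ : ℕ → PowerSeries
eulerFactor²⁴ k = (1ₚ ⊖ q^ k) ^ₚ 24

τ : ℕ → ℤ
τ = q^ 1 ⊛ ∏∞ eulerFactor²⁴

_≡1mod-q^_ : PowerSeries → ℕ → Set
a ≡1mod-q^ k = ∀ i → i < k → a i ≡ 1ₚ i

⊛-≡1 : ∀ a {k} → a ≡1mod-q^ k → ∀ b n → n < k → (a ⊛ b) n ≡ b n
⊛-≡1 a {k} a≡1 b n n<k = begin
  a 0 * b n + ∑[ i < n ] (a (suc (toℕ i)) * b (n ∸ suc (toℕ i)))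
    ≡⟨ cong₂ _+_ (cong (_* b n) (a≡1 0 (ℕ.≤-<-trans z≤n n<k))) (sum-cong-≗ vanish) ⟩
  1ℤ * b n + ∑[ i < n ] 0ℤ
    ≡⟨ cong₂ _+_ (*-identityˡ (b n)) (sum-replicate-zero n) ⟩
  b n + 0ℤ
    ≡⟨ +-identityʳ (b n) ⟩
  b n ∎
  where
  open ≡-Reasoning
  vanish : (i : Fin n) → a (suc (toℕ i)) * b (n ∸ suc (toℕ i)) ≡ 0ℤ
  vanish i = trans
    (cong (_* b (n ∸ suc (toℕ i))) (a≡1 (suc (toℕ i)) (ℕ.≤-<-trans (toℕ<n i) n<k)))
    (*-zeroˡ (b (n ∸ suc (toℕ i))))

^ₚ-≡1 : ∀ a {k} → a ≡1mod-q^ k → ∀ m → (a ^ₚ m) ≡1mod-q^ k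
^ₚ-≡1 a a≡1 zero    i i<k = refl
^ₚ-≡1 a a≡1 (suc m) i i<k = trans (⊛-≡1 a a≡1 (a ^ₚ m) i i<k) (^ₚ-≡1 a a≡1 m i i<k)

∏≤-stable : ∀ a → (∀ k → a k ≡1mod-q^ k) → ∀ {n N} → n ≤ N → ∏≤ N a n ≡ ∏∞ a n
∏≤-stable a a≡1 {n} n≤N = go (ℕ.≤⇒≤′ n≤N)
  where
  go : ∀ {N} → n ℕ.≤′ N → ∏≤ N a n ≡ ∏∞ a n
  go ℕ.≤′-refl = refl
  go {suc N} (ℕ.≤′-step n≤N) =
    trans (⊛-≡1 (a (suc N)) (a≡1 (suc N)) (∏≤ N a) n (s≤s (ℕ.≤′⇒≤ n≤N))) (go n≤N)

eulerFactor²⁴-≡1 : ∀ k → eulerFactor²⁴ k ≡1mod-q^ k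
eulerFactor²⁴-≡1 k = ^ₚ-≡1 (1ₚ ⊖ q^ k) (1-qᵏ k) 24
  where
  q^-low : ∀ k i → i < k → (q^ k) i ≡ 0ℤ
  q^-low (suc k) zero    _         = refl
  q^-low (suc k) (suc i) (s≤s i<k) = q^-low k i i<k

  1-qᵏ : ∀ k → (1ₚ ⊖ q^ k) ≡1mod-q^ k
  1-qᵏ k i i<k = trans (cong (λ x → 1ₚ i - x) (q^-low k i i<k)) (+-identityʳ (1ₚ i))

{-# OPTIONS --safe #-}
module Submission where

-- Let s = Σ σ(n) qⁿ, P = 1 − 24 s and θ = q d/dq.  Logarithmic differentiation of the product gives
-- θ τ = P τ.  Chazy's equation θ³s = θ²s + 36 (θs)² − 24 s θ²s implies that
-- F = θ⁴s − 24 (s θ⁴s − 16 θs θ³s + 18 (θ²s)²) satisfies θ F = P F as well, and since P has constant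
-- term 1, τ and F agree because their coefficients of 1 and q do: this is (i).  The other identities
-- follow from (i), Chazy's equation and 12 s² = 5 Σ σ₃(n) qⁿ + s − 6 θs.
--
-- The last two equations evaluate sums over the solutions of a x + b y = n in positive integers.
-- The subtractive step (a, b, x, y) ↦ (x + y, y, a, b − a) maps the solutions with a < b bijectively
-- to those with a > b.  Hence only the diagonal a = b contributes to the sum of a polynomial that
-- changes sign under this map.

open import Algebra.Bundles using (CommutativeRing)
import Algebra.Solver.Ring
open import Algebra.Solver.Ring.AlmostCommutativeRing
  using (AlmostCommutativeRing; fromCommutativeRing; _-Raw-AlmostCommutative⟶_; Induced-equivalence)
open import Data.Bool.Base using (if_then_else_)
open import Data.Fin.Base using (toℕ)
open import Data.Fin.Properties using (toℕ≤pred[n])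
open import Data.Integer.Base using (ℤ; +_; -[1+_]; 0ℤ; 1ℤ; +-*-rawRing)
import Data.Integer.Properties as ℤ
open import Data.Integer.Solver using (module +-*-Solver)
open import Data.Integer.Tactic.RingSolver using (solve-∀)
open import Data.List.Base using (List; []; _∷_; _++_; applyUpTo; filter; map; cartesianProduct)
open import Data.List.Membership.Propositional using (_∈_)
open import Data.List.Membership.Propositional.Properties
  using (∈-map⁺; ∈-map⁻; ∈-++⁺ˡ; ∈-++⁺ʳ; ∈-++⁻; ∈-filter⁺; ∈-filter⁻; ∈-applyUpTo⁺; ∈-applyUpTo⁻
        ; ∈-cartesianProduct⁺; ∈-cartesianProduct⁻)
open import Data.List.Membership.Propositional.Properties.WithK using (unique∧set⇒bag)
import Data.List.Properties as List
open import Data.List.Relation.Binary.BagAndSetEquality using (∼bag⇒↭)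
open import Data.List.Relation.Binary.Permutation.Propositional as ↭ using (_↭_)
open import Data.List.Relation.Unary.All as All using ([]; _∷_)
open import Data.List.Relation.Unary.AllPairs using ([]; _∷_)
open import Data.List.Relation.Unary.Any using (here; there)
open import Data.List.Relation.Unary.Unique.Propositional using (Unique)
import Data.List.Relation.Unary.Unique.Propositional.Properties as Unique
import Data.Maybe.Base as Maybe
open import Data.Nat.Base as ℕ using (ℕ; zero; suc; _∸_; _≤_; _<_; z≤n; s≤s)
open import Data.Nat.Divisibility using (_∣_; _∣?_; ∣m+n∣m⇒∣n; ∣m∣n⇒∣m+n; ∣-refl; ∣⇒≤; m∣m*n)
open import Data.Nat.DivMod using (m*[n/m]≡n; m*n/n≡m; m≥n⇒m/n>0)
import Data.Nat.ListAction as ListAction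
open import Data.Nat.ListAction.Properties using (sum-++)
import Data.Nat.Properties as ℕ
open import Data.Nat.Tactic.RingSolver using () renaming (solve-∀ to ℕ-solve-∀)
open import Data.Product.Base using (_×_; _,_; proj₁; proj₂)
open import Data.Rational.Base as ℚ using (ℚ; _/_; toℚᵘ)
import Data.Rational.Properties as ℚ
open import Data.Rational.Unnormalised.Base as ℚᵘ using (mkℚᵘ; *≡*)
import Data.Rational.Unnormalised.Properties as ℚᵘ
open import Data.Sum.Base using (inj₁; inj₂)
open import Function.Base using (_∘_)
open import Function.Bundles using (mk⇔)
open import Level using (0ℓ)
open import Relation.Binary.Bundles using (module Setoid)
open import Relation.Binary.Definitions using (WeaklyDecidable; tri<; tri≈; tri>)
open import Relation.Binary.PropositionalEquality
  using (_≡_; _≗_; refl; sym; trans; cong; cong₂; subst; module ≡-Reasoning; _→-setoid_)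
open import Relation.Nullary.Decidable using (does; yes; no; dec⇒maybe; dec-true; dec-false)
open import Relation.Nullary.Negation using (¬_)
open import Relation.Unary using (Pred; Decidable)
open import Defs

-- Differential consequences of Chazy's equation

-- Modular forms and convergence are avoided because Chazy's equation closes up the differential
-- algebra: with u = θs and v = θ²s, polynomials in P, u, v are stable under θ, so θ F = P F becomes
-- a polynomial identity. The constants of F are forced by it. For α P θ⁴s + β θs θ³s + γ (θ²s)² it
-- amounts to 48 α + β + γ = 0 and 84 β + 72 γ = 1152 α, whose solutions are the multiples of (1, 24
-- · 16, -24 · 18); the coefficient of q fixes α = 1. On coefficients F has the kernel m⁴ - 16 m³k +
-- 18 m²k² with m + k = n, and k = n - m turns it into that of (i), known as Niebur's formula. The
-- remaining identities exist because n⁴(σ₃(n) - σ(n)) is itself a convolution of σ with σ whose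
-- kernel is a combination of m⁴, m³n and m²n². Any multiple of this relation can be added to (i):
-- one choice removes m²n², another removes σ(n).

record DifferentialRing : Set₁ where
  field
    ring      : AlmostCommutativeRing 0ℓ 0ℓ
    constants : +-*-rawRing -Raw-AlmostCommutative⟶ ring

  open AlmostCommutativeRing ring public renaming (refl to ≈-refl; sym to ≈-sym; trans to ≈-trans)
  open _-Raw-AlmostCommutative⟶_ constants public using () renaming (⟦_⟧ to const)

  field
    θ         : Carrier → Carrier
    θ-cong    : ∀ {a b} → a ≈ b → θ a ≈ θ b
    θ-+       : ∀ a b → θ (a + b) ≈ θ a + θ b
    θ-*       : ∀ a b → θ (a * b) ≈ θ a * b + a * θ b
    θ-const   : ∀ c → θ (const c) ≈ const 0ℤ

-- Over an abstract differential ring, s, θs and θ²s are atoms, so every claim is an identity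
-- between polynomials with integer coefficients and falls to the ring solver. Convolution sums
-- never enter.
module ChazyEquation (D : DifferentialRing) where
  open DifferentialRing D

  private
    _coeff≟_ : WeaklyDecidable (Induced-equivalence constants)
    c coeff≟ d = Maybe.map (λ { refl → ≈-refl }) (dec⇒maybe (c ℤ.≟ d))

  open Algebra.Solver.Ring +-*-rawRing ring constants _coeff≟_
    using (solve; con; _:=_; _:+_; _:*_)

  private
    variable
      a a′ b b′ : Carrier

  private
    θ+ : θ a ≈ a′ → θ b ≈ b′ → θ (a + b) ≈ a′ + b′
    θ+ {a} {b = b} p q = ≈-trans (θ-+ a b) (+-cong p q)

    θ* : θ a ≈ a′ → θ b ≈ b′ → θ (a * b) ≈ a′ * b + a * b′
    θ* {a} {b = b} p q = ≈-trans (θ-* a b) (+-cong (*-cong p ≈-refl) (*-cong ≈-refl q))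

    θc : ∀ c → θ a ≈ a′ → θ (const c * a) ≈ const 0ℤ * a + const c * a′
    θc c p = θ* (θ-const c) p

  eisenstein₂ : Carrier → Carrier
  eisenstein₂ s = const 1ℤ + const (-[1+ 23 ]) * s

  -- With P = 1 - 24 s this is -(P θ⁴P - 16 θP θ³P + 18 (θ²P)²) / 24, a quadratic form in the
  -- derivatives of P. In each product the higher derivative comes first, so that the convolution
  -- kernel contains only monomials divisible by m².
  cuspForm : Carrier → Carrier
  cuspForm s = θ (θ (θ (θ s))) + const (-[1+ 23 ]) *
      (θ (θ (θ (θ s))) * s + const (-[1+ 15 ]) * (θ (θ (θ s)) * θ s) + const (+ 18) * (θ (θ s) * θ (θ s)))

  module _ (s : Carrier)
           -- The term -24 s θ²s is split symmetrically, like the kernel of the convolution identity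
           -- that yields it.
           (chazy : θ (θ (θ s)) ≈ θ (θ s) + const (+ 36) * (θ s * θ s)
                                  + const (-[1+ 11 ]) * (θ (θ s) * s + s * θ (θ s)))
    where
    private
      p u v : Carrier
      p = eisenstein₂ s
      u = θ s
      v = θ (θ s)

      θp : θ p ≈ const -[1+ 23 ] * u
      θp = ≈-trans (θ+ (θ-const 1ℤ) (θc -[1+ 23 ] ≈-refl)) (solve 2
        (λ s u → con 0ℤ :+ (con 0ℤ :* s :+ con -[1+ 23 ] :* u) := con -[1+ 23 ] :* u) ≈-refl s u)

      θv : θ v ≈ p * v + const (+ 36) * (u * u)
      θv = ≈-trans chazy (solve 3
        (λ s u v → v :+ con (+ 36) :* (u :* u) :+ con -[1+ 11 ] :* (v :* s :+ s :* v)
                := (con 1ℤ :+ con -[1+ 23 ] :* s) :* v :+ con (+ 36) :* (u :* u))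
        ≈-refl s u v)

      θθv : θ (θ v) ≈ p * (p * v) + const (+ 36) * (p * (u * u)) + const (+ 48) * (u * v)
      θθv = ≈-trans (≈-trans (θ-cong θv) (θ+ (θ* θp θv) (θc (+ 36) (θ* ≈-refl ≈-refl)))) (solve 3
        (λ p u v → (con -[1+ 23 ] :* u) :* v :+ p :* (p :* v :+ con (+ 36) :* (u :* u))
                   :+ (con 0ℤ :* (u :* u) :+ con (+ 36) :* (v :* u :+ u :* v))
                := p :* (p :* v) :+ con (+ 36) :* (p :* (u :* u)) :+ con (+ 48) :* (u :* v))
        ≈-refl p u v)

      -- 1728 times this is Q³ − R² in Ramanujan's notation, with p = P.
      polynomial : Carrier
      polynomial = (p * (p * p)) * v + const (+ 36) * ((p * p) * (u * u))
          + const (+ 432) * (p * (u * v)) + const (+ 13824) * (u * (u * u))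
          + const (-[1+ 431 ]) * (v * v)

      cuspForm-polynomial : cuspForm s ≈ polynomial
      cuspForm-polynomial = ≈-trans
        (+-cong θθv (*-cong ≈-refl
          (+-cong (+-cong (*-cong θθv ≈-refl) (*-cong ≈-refl (*-cong θv ≈-refl))) ≈-refl)))
        (solve 3
          (λ s u v →
            let p = con 1ℤ :+ con -[1+ 23 ] :* s
                v′ = p :* v :+ con (+ 36) :* (u :* u)
                v″ = p :* (p :* v) :+ con (+ 36) :* (p :* (u :* u)) :+ con (+ 48) :* (u :* v)
            in v″ :+ con -[1+ 23 ] :* (v″ :* s :+ con -[1+ 15 ] :* (v′ :* u) :+ con (+ 18) :* (v :* v))
            := (p :* (p :* p)) :* v :+ con (+ 36) :* ((p :* p) :* (u :* u))
               :+ con (+ 432) :* (p :* (u :* v)) :+ con (+ 13824) :* (u :* (u :* u))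
               :+ con -[1+ 431 ] :* (v :* v))
          ≈-refl s u v)

      θ-polynomial : θ polynomial ≈ p * polynomial
      θ-polynomial = ≈-trans
        (θ+ (θ+ (θ+ (θ+
          (θ* (θ* θp (θ* θp θp)) θv)
          (θc (+ 36) (θ* (θ* θp θp) (θ* θu θu))))
          (θc (+ 432) (θ* θp (θ* θu θv))))
          (θc (+ 13824) (θ* θu (θ* θu θu))))
          (θc -[1+ 431 ] (θ* θv θv)))
        (solve 3
          (λ p u v →
            let p′ = con -[1+ 23 ] :* u
                v′ = p :* v :+ con (+ 36) :* (u :* u)
            in (p′ :* (p :* p) :+ p :* (p′ :* p :+ p :* p′)) :* v :+ (p :* (p :* p)) :* v′
               :+ (con 0ℤ :* ((p :* p) :* (u :* u))
                   :+ con (+ 36) :* ((p′ :* p :+ p :* p′) :* (u :* u) :+ (p :* p) :* (v :* u :+ u :* v)))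
               :+ (con 0ℤ :* (p :* (u :* v)) :+ con (+ 432) :* (p′ :* (u :* v) :+ p :* (v :* v :+ u :* v′)))
               :+ (con 0ℤ :* (u :* (u :* u)) :+ con (+ 13824) :* (v :* (u :* u) :+ u :* (v :* u :+ u :* v)))
               :+ (con 0ℤ :* (v :* v) :+ con -[1+ 431 ] :* (v′ :* v :+ v :* v′))
            := p :* ((p :* (p :* p)) :* v :+ con (+ 36) :* ((p :* p) :* (u :* u))
               :+ con (+ 432) :* (p :* (u :* v)) :+ con (+ 13824) :* (u :* (u :* u))
               :+ con -[1+ 431 ] :* (v :* v)))
          ≈-refl p u v)
        where
        θu : θ u ≈ v
        θu = ≈-refl

    θ-cuspForm : θ (cuspForm s) ≈ p * cuspForm s
    θ-cuspForm = ≈-trans (θ-cong cuspForm-polynomial)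
      (≈-trans θ-polynomial (*-cong ≈-refl (≈-sym cuspForm-polynomial)))

open import Data.Integer.Base using (_+_; _-_; _*_; -_; _^_)
open import Algebra.Properties.Semiring.Sum ℤ.+-*-semiring
  using (sum-syntax; sum-cong-≗; sum-replicate-zero; ∑-distrib-+; *-distribˡ-sum)

-- The differential ring of formal power series

infixl 6 _⊞_
infixr 7 _·_
infix  8 ⊟_

_⊞_ : PowerSeries → PowerSeries → PowerSeries
(a ⊞ b) n = a n + b n

⊟_ : PowerSeries → PowerSeries
(⊟ a) n = - a n

0ₚ : PowerSeries
0ₚ n = 0ℤ

-- `(a ⊛ b) (suc n)` unfolds definitionally to `a 0 * b (suc n) + (tail a ⊛ b) n`. This is the
-- recursion behind the inductions on coefficients below.
tail : PowerSeries → PowerSeries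
tail a = a ∘ suc

_·_ : ℤ → PowerSeries → PowerSeries
(c · a) n = c * a n

const : ℤ → PowerSeries
const c zero    = c
const c (suc n) = 0ℤ

⊛-cong : ∀ {a a′ b b′} → a ≗ a′ → b ≗ b′ → a ⊛ b ≗ a′ ⊛ b′
⊛-cong a≗a′ b≗b′ n = sum-cong-≗ {suc n} λ i → cong₂ _*_ (a≗a′ (toℕ i)) (b≗b′ (n ∸ toℕ i))

⊛-distribʳ-⊞ : ∀ c a b → (a ⊞ b) ⊛ c ≗ (a ⊛ c) ⊞ (b ⊛ c)
⊛-distribʳ-⊞ c a b n = trans
  (sum-cong-≗ {suc n} λ i → ℤ.*-distribʳ-+ (c (n ∸ toℕ i)) (a (toℕ i)) (b (toℕ i)))
  (∑-distrib-+ {suc n} (λ i → a (toℕ i) * c (n ∸ toℕ i)) (λ i → b (toℕ i) * c (n ∸ toℕ i)))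

·-⊛ : ∀ c a b → (c · a) ⊛ b ≗ c · (a ⊛ b)
·-⊛ c a b n = trans
  (sum-cong-≗ {suc n} λ i → ℤ.*-assoc c (a (toℕ i)) (b (n ∸ toℕ i)))
  (sym (*-distribˡ-sum {suc n} c λ i → a (toℕ i) * b (n ∸ toℕ i)))

-- The product unfolds by itself only at the low end of its first factor. Peeling the low end of the
-- second factor as well is what makes commutativity an induction.
⊛-unfoldʳ : ∀ a b n → (a ⊛ b) (suc n) ≡ (a ⊛ tail b) n + a (suc n) * b 0
⊛-unfoldʳ a b zero = lemma (a 0 * b 1) (a 1 * b 0)
  where
  lemma : ∀ x y → x + (y + 0ℤ) ≡ x + 0ℤ + y
  lemma = solve-∀
⊛-unfoldʳ a b (suc n) = trans
  (cong (λ z → a 0 * b (suc (suc n)) + z) (⊛-unfoldʳ (tail a) b n))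
  (sym (ℤ.+-assoc (a 0 * b (suc (suc n))) ((tail a ⊛ tail b) n) (a (suc (suc n)) * b 0)))

⊛-comm : ∀ a b → a ⊛ b ≗ b ⊛ a
⊛-comm a b zero = cong (_+ 0ℤ) (ℤ.*-comm (a 0) (b 0))
⊛-comm a b (suc n) = begin
  a 0 * b (suc n) + (tail a ⊛ b) n ≡⟨ cong₂ _+_ (ℤ.*-comm (a 0) (b (suc n))) (⊛-comm (tail a) b n) ⟩
  b (suc n) * a 0 + (b ⊛ tail a) n ≡⟨ ℤ.+-comm (b (suc n) * a 0) ((b ⊛ tail a) n) ⟩
  (b ⊛ tail a) n + b (suc n) * a 0 ≡⟨ ⊛-unfoldʳ b a n ⟨
  (b ⊛ a) (suc n) ∎
  where open ≡-Reasoning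

⊛-assoc : ∀ a b c → (a ⊛ b) ⊛ c ≗ a ⊛ (b ⊛ c)
⊛-assoc a b c zero = lemma (a 0) (b 0) (c 0)
  where
  lemma : ∀ x y z → (x * y + 0ℤ) * z + 0ℤ ≡ x * (y * z + 0ℤ) + 0ℤ
  lemma = solve-∀
⊛-assoc a b c (suc n) = begin
  (a 0 * b 0 + 0ℤ) * c (suc n) + (((a 0 · tail b) ⊞ (tail a ⊛ b)) ⊛ c) n
    ≡⟨ cong (λ z → (a 0 * b 0 + 0ℤ) * c (suc n) + z) (⊛-distribʳ-⊞ c (a 0 · tail b) (tail a ⊛ b) n) ⟩
  (a 0 * b 0 + 0ℤ) * c (suc n) + (((a 0 · tail b) ⊛ c) n + ((tail a ⊛ b) ⊛ c) n)
    ≡⟨ cong (λ z → (a 0 * b 0 + 0ℤ) * c (suc n) + z)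
            (cong₂ _+_ (·-⊛ (a 0) (tail b) c n) (⊛-assoc (tail a) b c n)) ⟩
  (a 0 * b 0 + 0ℤ) * c (suc n) + (a 0 * (tail b ⊛ c) n + (tail a ⊛ (b ⊛ c)) n)
    ≡⟨ lemma (a 0) (b 0) (c (suc n)) ((tail b ⊛ c) n) ((tail a ⊛ (b ⊛ c)) n) ⟩
  a 0 * (b 0 * c (suc n) + (tail b ⊛ c) n) + (tail a ⊛ (b ⊛ c)) n ∎
  where
  open ≡-Reasoning
  lemma : ∀ x y z u v → (x * y + 0ℤ) * z + (x * u + v) ≡ x * (y * z + u) + v
  lemma = solve-∀

⊛-zeroˡ : ∀ a → 0ₚ ⊛ a ≗ 0ₚ
⊛-zeroˡ a n = trans (sum-cong-≗ {suc n} λ i → ℤ.*-zeroˡ (a (n ∸ toℕ i))) (sum-replicate-zero (suc n))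

const-⊛ : ∀ c a → const c ⊛ a ≗ c · a
const-⊛ c a zero    = ℤ.+-identityʳ (c * a 0)
const-⊛ c a (suc n) = trans (cong (λ z → c * a (suc n) + z) (⊛-zeroˡ a n)) (ℤ.+-identityʳ (c * a (suc n)))

1ₚ≗const : 1ₚ ≗ const 1ℤ
1ₚ≗const zero    = refl
1ₚ≗const (suc n) = refl

⊛-identityˡ : ∀ a → 1ₚ ⊛ a ≗ a
⊛-identityˡ a n = trans (⊛-cong {b = a} 1ₚ≗const (λ _ → refl) n) (trans (const-⊛ 1ℤ a n) (ℤ.*-identityˡ (a n)))

⊛-commutativeRing : CommutativeRing _ _
⊛-commutativeRing = record
  { Carrier = PowerSeries ; _≈_ = _≗_ ; _+_ = _⊞_ ; _*_ = _⊛_ ; -_ = ⊟_ ; 0# = 0ₚ ; 1# = 1ₚ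
  ; isCommutativeRing = record
    { isRing = record
      { +-isAbelianGroup = record
        { isGroup = record
          { isMonoid = record
            { isSemigroup = record
              { isMagma = record
                { isEquivalence = Setoid.isEquivalence (ℕ →-setoid ℤ)
                ; ∙-cong = λ p q n → cong₂ _+_ (p n) (q n)
                }
              ; assoc = λ a b c n → ℤ.+-assoc (a n) (b n) (c n)
              }
            ; identity = (λ a n → ℤ.+-identityˡ (a n)) , (λ a n → ℤ.+-identityʳ (a n))
            }
          ; inverse = (λ a n → ℤ.+-inverseˡ (a n)) , (λ a n → ℤ.+-inverseʳ (a n))
          ; ⁻¹-cong = λ p n → cong -_ (p n)
          }
        ; comm = λ a b n → ℤ.+-comm (a n) (b n)
        }
      ; *-cong = ⊛-cong
      ; *-assoc = ⊛-assoc
      ; *-identity = ⊛-identityˡ , (λ a n → trans (⊛-comm a 1ₚ n) (⊛-identityˡ a n))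
      ; distrib = (λ c a b n → trans (⊛-comm c (a ⊞ b) n) (trans (⊛-distribʳ-⊞ c a b n)
                                 (cong₂ _+_ (⊛-comm a c n) (⊛-comm b c n))))
                , ⊛-distribʳ-⊞
      }
    ; *-comm = ⊛-comm
    }
  }

seriesRing : AlmostCommutativeRing _ _
seriesRing = fromCommutativeRing ⊛-commutativeRing

constants : +-*-rawRing -Raw-AlmostCommutative⟶ seriesRing
constants = record
  { ⟦_⟧    = const
  ; +-homo = λ { c d zero → refl ; c d (suc n) → refl }
  ; *-homo = λ { c d zero → sym (ℤ.+-identityʳ (c * d))
               ; c d (suc n) → sym (trans (const-⊛ c (const d) (suc n)) (ℤ.*-zeroʳ c)) }
  ; -‿homo = λ { c zero → refl ; c (suc n) → refl }
  ; 0-homo = λ { zero → refl ; (suc n) → refl }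
  ; 1-homo = λ n → sym (1ₚ≗const n)
  }

θ : PowerSeries → PowerSeries
θ a n = + n * a n

θ-cong : ∀ {a b} → a ≗ b → θ a ≗ θ b
θ-cong a≗b n = cong (+ n *_) (a≗b n)

θ-⊞ : ∀ a b → θ (a ⊞ b) ≗ θ a ⊞ θ b
θ-⊞ a b n = ℤ.*-distribˡ-+ (+ n) (a n) (b n)

θ-const : ∀ c → θ (const c) ≗ const 0ℤ
θ-const c zero    = refl
θ-const c (suc n) = ℤ.*-zeroʳ (+ suc n)

θ-⊛ : ∀ a b → θ (a ⊛ b) ≗ (θ a ⊛ b) ⊞ (a ⊛ θ b)
θ-⊛ a b zero = lemma (a 0) (b 0)
  where
  lemma : ∀ x y → 0ℤ * (x * y + 0ℤ) ≡ 0ℤ * x * y + 0ℤ + (x * (0ℤ * y) + 0ℤ)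
  lemma = solve-∀
θ-⊛ a b (suc n) = begin
  (1ℤ + + n) * (a 0 * b (suc n) + (tail a ⊛ b) n)
    ≡⟨ lemma₁ (+ n) (a 0) (b (suc n)) ((tail a ⊛ b) n) ⟩
  0ℤ * a 0 * b (suc n) + a 0 * ((1ℤ + + n) * b (suc n)) + ((tail a ⊛ b) n + + n * (tail a ⊛ b) n)
    ≡⟨ cong (λ z → 0ℤ * a 0 * b (suc n) + a 0 * ((1ℤ + + n) * b (suc n)) + ((tail a ⊛ b) n + z)) (θ-⊛ (tail a) b n) ⟩
  0ℤ * a 0 * b (suc n) + a 0 * ((1ℤ + + n) * b (suc n)) + ((tail a ⊛ b) n + ((θ (tail a) ⊛ b) n + (tail a ⊛ θ b) n))
    ≡⟨ lemma₂ (0ℤ * a 0 * b (suc n)) (a 0 * ((1ℤ + + n) * b (suc n))) ((tail a ⊛ b) n) ((θ (tail a) ⊛ b) n) ((tail a ⊛ θ b) n) ⟩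
  0ℤ * a 0 * b (suc n) + ((tail a ⊛ b) n + (θ (tail a) ⊛ b) n) + (a 0 * ((1ℤ + + n) * b (suc n)) + (tail a ⊛ θ b) n)
    ≡⟨ cong (λ z → 0ℤ * a 0 * b (suc n) + z + (a 0 * ((1ℤ + + n) * b (suc n)) + (tail a ⊛ θ b) n)) tail-θ ⟨
  0ℤ * a 0 * b (suc n) + (tail (θ a) ⊛ b) n + (a 0 * ((1ℤ + + n) * b (suc n)) + (tail a ⊛ θ b) n) ∎
  where
  open ≡-Reasoning
  lemma₁ : ∀ k x y z → (1ℤ + k) * (x * y + z) ≡ 0ℤ * x * y + x * ((1ℤ + k) * y) + (z + k * z)
  lemma₁ = solve-∀
  lemma₂ : ∀ x y z u v → x + y + (z + (u + v)) ≡ x + (z + u) + (y + v)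
  lemma₂ = solve-∀
  lemma₃ : ∀ k x → (1ℤ + k) * x ≡ x + k * x
  lemma₃ = solve-∀
  -- Shifting does not commute with θ: the coefficient of index 1 + i carries the weight 1 + i, not
  -- i, which leaves an extra `tail a`.
  tail-θ : (tail (θ a) ⊛ b) n ≡ (tail a ⊛ b) n + (θ (tail a) ⊛ b) n
  tail-θ = trans (⊛-cong {b = b} (λ i → lemma₃ (+ i) (a (suc i))) (λ _ → refl) n)
                 (⊛-distribʳ-⊞ b (tail a) (θ (tail a)) n)

open CommutativeRing ⊛-commutativeRing using ()
  renaming (refl to ≗-refl; sym to ≗-sym; trans to ≗-trans; +-cong to ⊞-cong; distribˡ to ⊛-distribˡ-⊞
           ; setoid to seriesSetoid)
import Relation.Binary.Reasoning.Setoid seriesSetoid as ≗-Reasoning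

powerSeries : DifferentialRing
powerSeries = record
  { ring      = seriesRing
  ; constants = constants
  ; θ         = θ
  ; θ-cong    = θ-cong
  ; θ-+       = θ-⊞
  ; θ-*       = θ-⊛
  ; θ-const   = θ-const
  }

-- Uniqueness for the differential equation θ a = p a

module _ {p a b : PowerSeries} (p₀ : p 0 ≡ 1ℤ) (θa : θ a ≗ p ⊛ a) (θb : θ b ≗ p ⊛ b)
         (a₀≡b₀ : a 0 ≡ b 0) (a₁≡b₁ : a 1 ≡ b 1) where
  private
    -- The coefficient of index 2 + n occurs with factor 2 + n on the left and with factor `p 0` = 1
    -- on the right; the difference `suc n` can be cancelled, so earlier coefficients determine it.
    -- At index 1 the two occurrences cancel completely, which is why the coefficient of q has to be
    -- prescribed.
    recurrence : ∀ {c} → θ c ≗ p ⊛ c → ∀ n → + suc n * c (2 ℕ.+ n) ≡ (tail p ⊛ c) (suc n)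
    recurrence {c} θc n = begin
      + suc n * c (2 ℕ.+ n)                           ≡⟨ lemma (+ suc n) (c (2 ℕ.+ n)) ⟩
      + suc (suc n) * c (2 ℕ.+ n) - 1ℤ * c (2 ℕ.+ n)  ≡⟨ cong (_- 1ℤ * c (2 ℕ.+ n)) (θc (2 ℕ.+ n)) ⟩
      p 0 * c (2 ℕ.+ n) + (tail p ⊛ c) (suc n) - 1ℤ * c (2 ℕ.+ n)
        ≡⟨ cong (λ z → z * c (2 ℕ.+ n) + (tail p ⊛ c) (suc n) - 1ℤ * c (2 ℕ.+ n)) p₀ ⟩
      1ℤ * c (2 ℕ.+ n) + (tail p ⊛ c) (suc n) - 1ℤ * c (2 ℕ.+ n)
        ≡⟨ lemma₂ (1ℤ * c (2 ℕ.+ n)) ((tail p ⊛ c) (suc n)) ⟩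
      (tail p ⊛ c) (suc n) ∎
      where
      open ≡-Reasoning
      lemma : ∀ k x → k * x ≡ (1ℤ + k) * x - 1ℤ * x
      lemma = solve-∀
      lemma₂ : ∀ x y → x + y - x ≡ y
      lemma₂ = solve-∀

    agree : ∀ n m → m ≤ n → a m ≡ b m
    agree n       zero          _         = a₀≡b₀
    agree n       (suc zero)    _         = a₁≡b₁
    agree (suc n) (suc (suc m)) (s≤s m<n) = ℤ.*-cancelˡ-≡ (+ suc m) _ _ (begin
      + suc m * a (2 ℕ.+ m)  ≡⟨ recurrence θa m ⟩
      (tail p ⊛ a) (suc m)   ≡⟨ sum-cong-≗ {2 ℕ.+ m} (λ i → cong (tail p (toℕ i) *_)
                                  (agree n (suc m ∸ toℕ i) (ℕ.≤-trans (ℕ.m∸n≤m (suc m) (toℕ i)) m<n))) ⟩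
      (tail p ⊛ b) (suc m)   ≡⟨ recurrence θb m ⟨
      + suc m * b (2 ℕ.+ m)  ∎)
      where open ≡-Reasoning

  θ≗p⊛-unique : a ≗ b
  θ≗p⊛-unique n = agree n n ℕ.≤-refl

-- Logarithmic derivatives

-- The multiplicative form avoids the quotient θ a / a. It therefore covers `q^ 1`, which is not
-- invertible but has logarithmic derivative 1.
record _hasLogDerivative_ (a e : PowerSeries) : Set where
  constructor logDerivative
  field θ≗ : θ a ≗ a ⊛ e

open _hasLogDerivative_

logDerivative-≗ : ∀ {a e e′} → e ≗ e′ → a hasLogDerivative e → a hasLogDerivative e′
logDerivative-≗ {a} e≗e′ (logDerivative θa) = logDerivative (≗-trans θa (⊛-cong {a} ≗-refl e≗e′))

logDerivative-⊛ : ∀ {a b e f} → a hasLogDerivative e → b hasLogDerivative f → (a ⊛ b) hasLogDerivative (e ⊞ f)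
logDerivative-⊛ {a} {b} {e} {f} (logDerivative θa) (logDerivative θb) = logDerivative (begin
  θ (a ⊛ b)                       ≈⟨ θ-⊛ a b ⟩
  (θ a ⊛ b) ⊞ (a ⊛ θ b)           ≈⟨ ⊞-cong (⊛-cong {b = b} θa ≗-refl) (⊛-cong {a} ≗-refl θb) ⟩
  ((a ⊛ e) ⊛ b) ⊞ (a ⊛ (b ⊛ f))   ≈⟨ ⊞-cong (⊛-assoc a e b) (≗-sym (⊛-assoc a b f)) ⟩
  (a ⊛ (e ⊛ b)) ⊞ ((a ⊛ b) ⊛ f)   ≈⟨ ⊞-cong (⊛-cong {a} ≗-refl (⊛-comm e b)) (≗-refl {(a ⊛ b) ⊛ f}) ⟩
  (a ⊛ (b ⊛ e)) ⊞ ((a ⊛ b) ⊛ f)   ≈⟨ ⊞-cong (⊛-assoc a b e) (≗-refl {(a ⊛ b) ⊛ f}) ⟨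
  ((a ⊛ b) ⊛ e) ⊞ ((a ⊛ b) ⊛ f)   ≈⟨ ⊛-distribˡ-⊞ (a ⊛ b) e f ⟨
  (a ⊛ b) ⊛ (e ⊞ f)               ∎)
  where open ≗-Reasoning

θ1ₚ : θ 1ₚ ≗ 0ₚ
θ1ₚ zero    = refl
θ1ₚ (suc n) = ℤ.*-zeroʳ (+ suc n)

logDerivative-1ₚ : 1ₚ hasLogDerivative 0ₚ
logDerivative-1ₚ = logDerivative λ n → trans (θ1ₚ n) (sym (⊛-identityˡ 0ₚ n))

logDerivative-^ₚ : ∀ {a e} → a hasLogDerivative e → ∀ m → (a ^ₚ m) hasLogDerivative (+ m · e)
logDerivative-^ₚ {e = e} θa zero    = logDerivative-≗ (λ n → sym (ℤ.*-zeroˡ (e n))) logDerivative-1ₚ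
logDerivative-^ₚ {e = e} θa (suc m) = logDerivative-≗ (λ n → lemma (+ m) (e n))
  (logDerivative-⊛ θa (logDerivative-^ₚ θa m))
  where
  lemma : ∀ m x → x + m * x ≡ (1ℤ + m) * x
  lemma = solve-∀

-- The logarithmic derivative of the Euler product

∑≤ : ℕ → (ℕ → PowerSeries) → PowerSeries
∑≤ zero    e = 0ₚ
∑≤ (suc N) e = e (suc N) ⊞ ∑≤ N e

logDerivative-∏≤ : ∀ {a e} → (∀ k → a (suc k) hasLogDerivative e (suc k)) →
                   ∀ N → ∏≤ N a hasLogDerivative ∑≤ N e
logDerivative-∏≤ θa zero    = logDerivative-1ₚ
logDerivative-∏≤ θa (suc N) = logDerivative-⊛ (θa N) (logDerivative-∏≤ θa N)

q^-⊛-< : ∀ k a {n} → n < k → ((q^ k) ⊛ a) n ≡ 0ℤ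
q^-⊛-< (suc k) a {zero}  _         = trans (ℤ.+-identityʳ (0ℤ * a 0)) (ℤ.*-zeroˡ (a 0))
q^-⊛-< (suc k) a {suc n} (s≤s n<k) = cong₂ _+_ (ℤ.*-zeroˡ (a (suc n))) (q^-⊛-< k a n<k)

q^-⊛-+ : ∀ k a n → ((q^ k) ⊛ a) (k ℕ.+ n) ≡ a n
q^-⊛-+ zero    a n = ⊛-identityˡ a n
q^-⊛-+ (suc k) a n = trans
  (cong₂ _+_ (ℤ.*-zeroˡ (a (suc k ℕ.+ n))) (q^-⊛-+ k a n)) (ℤ.+-identityˡ (a n))

-- k q^k / (1 − q^k)
lambert : ℕ → PowerSeries
lambert k zero        = 0ℤ
lambert k n@(suc _)   = if does (k ∣? n) then + k else 0ℤ

lambert-∣ : ∀ {k n} → k ∣ suc n → lambert k (suc n) ≡ + k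
lambert-∣ {k} {n} k∣n rewrite dec-true (k ∣? suc n) k∣n = refl

lambert-∤ : ∀ {k n} → ¬ (k ∣ suc n) → lambert k (suc n) ≡ 0ℤ
lambert-∤ {k} {n} k∤n rewrite dec-false (k ∣? suc n) k∤n = refl

lambert-< : ∀ {k n} → n < k → lambert k n ≡ 0ℤ
lambert-< {k} {zero}  _   = refl
lambert-< {k} {suc n} n<k = lambert-∤ (λ k∣n → ℕ.<⇒≱ n<k (∣⇒≤ k∣n))

lambert-+ : ∀ k n → lambert k (k ℕ.+ suc n) ≡ lambert k (suc n)
lambert-+ k n rewrite ℕ.+-suc k n with k ∣? suc n
... | yes k∣n = lambert-∣ (subst (k ∣_) (ℕ.+-suc k n) (∣m∣n⇒∣m+n ∣-refl k∣n))
... | no  k∤n = lambert-∤ (λ k∣k+n → k∤n (∣m+n∣m⇒∣n (subst (k ∣_) (sym (ℕ.+-suc k n)) k∣k+n) ∣-refl))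

θq^ : ∀ k → θ (q^ k) ≗ + k · (q^ k)
θq^ k n = go k n (+ k) (+ n) λ where refl → refl
  where
  -- The factors are generalised to `x` and `y` so that they stay fixed while the recursion lowers
  -- both indices.
  go : ∀ k n x y → (k ≡ n → x ≡ y) → y * (q^ k) n ≡ x * (q^ k) n
  go zero    zero    x y eq = cong (_* 1ℤ) (sym (eq refl))
  go zero    (suc n) x y eq = trans (ℤ.*-zeroʳ y) (sym (ℤ.*-zeroʳ x))
  go (suc k) zero    x y eq = trans (ℤ.*-zeroʳ y) (sym (ℤ.*-zeroʳ x))
  go (suc k) (suc n) x y eq = go k n x y λ where refl → eq refl

-- Multiplying k (qᵏ + q²ᵏ + ⋯) by 1 - qᵏ telescopes to its first term.
lambert-q^ : ∀ k .{{_ : ℕ.NonZero k}} → lambert k ⊖ ((q^ k) ⊛ lambert k) ≗ + k · (q^ k)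
lambert-q^ (suc k) n with ℕ.<-≤-connex n (suc k)
... | inj₁ n<k rewrite lambert-< n<k | q^-⊛-< (suc k) (lambert (suc k)) n<k =
  sym (trans (cong (+ suc k *_) (q^-low (suc k) n n<k)) (ℤ.*-zeroʳ (+ suc k)))
  where
  q^-low : ∀ k i → i < k → (q^ k) i ≡ 0ℤ
  q^-low (suc k) zero    _         = refl
  q^-low (suc k) (suc i) (s≤s i<k) = q^-low k i i<k
... | inj₂ k≤n with ℕ.m≤n⇒∃[o]m+o≡n k≤n
... | m , refl rewrite q^-⊛-+ (suc k) (lambert (suc k)) m = step m
  where
  q^-diag : ∀ k → (q^ k) (k ℕ.+ 0) ≡ 1ℤ
  q^-diag zero    = refl
  q^-diag (suc k) = q^-diag k
  q^-above : ∀ k m → (q^ k) (k ℕ.+ suc m) ≡ 0ℤ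
  q^-above zero    m = refl
  q^-above (suc k) m = q^-above k m
  step : ∀ m → lambert (suc k) (suc k ℕ.+ m) - lambert (suc k) m ≡ + suc k * (q^ suc k) (suc k ℕ.+ m)
  -- At index k the subtracted coefficient is the constant term of `lambert`, which is 0 although k
  -- divides 0. Hence the single surviving term k qᵏ.
  step zero = trans (cong (_- 0ℤ) (lambert-∣ (subst (suc k ∣_) (sym (ℕ.+-identityʳ (suc k))) ∣-refl)))
    (trans (ℤ.+-identityʳ (+ suc k)) (sym (trans (cong (+ suc k *_) (q^-diag (suc k))) (ℤ.*-identityʳ (+ suc k)))))
  step (suc m) rewrite lambert-+ (suc k) m | q^-above (suc k) m =
    trans (ℤ.+-inverseʳ (lambert (suc k) (suc m))) (sym (ℤ.*-zeroʳ (+ suc k)))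

logDerivative-1-q^ : ∀ k .{{_ : ℕ.NonZero k}} → (1ₚ ⊖ q^ k) hasLogDerivative (⊟ lambert k)
logDerivative-1-q^ k = logDerivative (begin
  θ (1ₚ ⊖ q^ k)                            ≈⟨ (λ n → lemma₁ (+ n) (1ₚ n) ((q^ k) n)) ⟩
  θ 1ₚ ⊖ θ (q^ k)                          ≈⟨ (λ n → cong₂ _-_ (θ1ₚ n) (θq^ k n)) ⟩
  0ₚ ⊖ (+ k · (q^ k))                      ≈⟨ (λ n → cong (λ z → 0ℤ - z) (sym (lambert-q^ k n))) ⟩
  0ₚ ⊖ (lambert k ⊖ ((q^ k) ⊛ lambert k))  ≈⟨ (λ n → lemma₂ (lambert k n) (((q^ k) ⊛ lambert k) n)) ⟩
  (⊟ lambert k) ⊞ ((q^ k) ⊛ lambert k)     ≈⟨ ⊞-cong (≗-sym (⊛-identityˡ (⊟ lambert k))) (sign (q^ k) (lambert k)) ⟩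
  (1ₚ ⊛ ⊟ lambert k) ⊞ ((⊟ (q^ k)) ⊛ ⊟ lambert k) ≈⟨ ⊛-distribʳ-⊞ (⊟ lambert k) 1ₚ (⊟ (q^ k)) ⟨
  (1ₚ ⊖ q^ k) ⊛ (⊟ lambert k)              ∎)
  where
  open ≗-Reasoning
  lemma₁ : ∀ n x y → n * (x - y) ≡ n * x - n * y
  lemma₁ = solve-∀
  lemma₂ : ∀ x y → 0ℤ - (x - y) ≡ - x + y
  lemma₂ = solve-∀
  lemma₃ : ∀ x y → x * y ≡ - x * - y
  lemma₃ = solve-∀
  sign : ∀ a b → a ⊛ b ≗ (⊟ a) ⊛ (⊟ b)
  sign a b n = sum-cong-≗ {suc n} λ i → lemma₃ (a (toℕ i)) (b (n ∸ toℕ i))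

logDerivative-eulerFactor²⁴ : ∀ k → eulerFactor²⁴ (suc k) hasLogDerivative (+ 24 · ⊟ lambert (suc k))
logDerivative-eulerFactor²⁴ k = go (suc k)
  where
  power : ∀ k .{{_ : ℕ.NonZero k}} m → ((1ₚ ⊖ q^ k) ^ₚ m) hasLogDerivative (+ m · ⊟ lambert k)
  power k = logDerivative-^ₚ (logDerivative-1-q^ k)
  go : ∀ k .{{_ : ℕ.NonZero k}} → eulerFactor²⁴ k hasLogDerivative (+ 24 · ⊟ lambert k)
  go k = power k 24

eulerLogDerivative : ℕ → PowerSeries
eulerLogDerivative N = ∑≤ N (λ k → + 24 · ⊟ lambert k)

σ-series : PowerSeries
σ-series n = + σ 1 n

-- The number and the bound on its divisors are separated because the product truncated at N sees
-- exactly the divisors up to N. The diagonal N = n is `σ 1 n`.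
divisorSum≤ : ℕ → ℕ → ℕ
divisorSum≤ n N = ListAction.sum (map (ℕ._^ 1) (filter (_∣? n) (applyUpTo suc N)))

divisorSum≤-suc : ∀ n N → + divisorSum≤ (suc n) (suc N) ≡ lambert (suc N) (suc n) + + divisorSum≤ (suc n) N
divisorSum≤-suc n N = begin
  + ListAction.sum (map (ℕ._^ 1) (filter (_∣? suc n) (applyUpTo suc (suc N))))
    ≡⟨ cong (λ z → + ListAction.sum (map (ℕ._^ 1) (filter (_∣? suc n) z))) (List.applyUpTo-∷ʳ suc N) ⟨
  + ListAction.sum (map (ℕ._^ 1) (filter (_∣? suc n) (applyUpTo suc N ++ suc N ∷ [])))
    ≡⟨ cong (λ z → + ListAction.sum (map (ℕ._^ 1) z)) (List.filter-++ (_∣? suc n) (applyUpTo suc N) (suc N ∷ [])) ⟩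
  + ListAction.sum (map (ℕ._^ 1) (filter (_∣? suc n) (applyUpTo suc N) ++ filter (_∣? suc n) (suc N ∷ [])))
    ≡⟨ cong (λ z → + ListAction.sum z) (List.map-++ (ℕ._^ 1) (filter (_∣? suc n) (applyUpTo suc N)) _) ⟩
  + ListAction.sum (map (ℕ._^ 1) (filter (_∣? suc n) (applyUpTo suc N)) ++ map (ℕ._^ 1) (filter (_∣? suc n) (suc N ∷ [])))
    ≡⟨ cong +_ (sum-++ (map (ℕ._^ 1) (filter (_∣? suc n) (applyUpTo suc N))) _) ⟩
  + divisorSum≤ (suc n) N + + ListAction.sum (map (ℕ._^ 1) (filter (_∣? suc n) (suc N ∷ [])))
    ≡⟨ ℤ.+-comm (+ divisorSum≤ (suc n) N) (+ ListAction.sum (map (ℕ._^ 1) (filter (_∣? suc n) (suc N ∷ [])))) ⟩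
  + ListAction.sum (map (ℕ._^ 1) (filter (_∣? suc n) (suc N ∷ []))) + + divisorSum≤ (suc n) N
    ≡⟨ cong (_+ + divisorSum≤ (suc n) N) last ⟩
  lambert (suc N) (suc n) + + divisorSum≤ (suc n) N ∎
  where
  open ≡-Reasoning
  last : + ListAction.sum (map (ℕ._^ 1) (filter (_∣? suc n) (suc N ∷ []))) ≡ lambert (suc N) (suc n)
  last with suc N ∣? suc n
  ... | yes N∣n rewrite List.filter-accept (_∣? suc n) {xs = []} N∣n | lambert-∣ N∣n =
    cong +_ (trans (ℕ.+-identityʳ _) (ℕ.*-identityʳ (suc N)))
  ... | no  N∤n rewrite List.filter-reject (_∣? suc n) {xs = []} N∤n | lambert-∤ N∤n = refl

divisorSum≤-≥ : ∀ {n N} → suc n ≤ N → + divisorSum≤ (suc n) N ≡ σ-series (suc n)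
divisorSum≤-≥ {n} n<N = go (ℕ.≤⇒≤′ n<N)
  where
  go : ∀ {N} → suc n ℕ.≤′ N → + divisorSum≤ (suc n) N ≡ σ-series (suc n)
  go ℕ.≤′-refl = refl
  go {suc N} (ℕ.≤′-step n<N) = begin
    + divisorSum≤ (suc n) (suc N)                        ≡⟨ divisorSum≤-suc n N ⟩
    lambert (suc N) (suc n) + + divisorSum≤ (suc n) N    ≡⟨ cong₂ _+_ (lambert-< (s≤s (ℕ.≤′⇒≤ n<N))) (go n<N) ⟩
    0ℤ + σ-series (suc n)                                ≡⟨ ℤ.+-identityˡ (σ-series (suc n)) ⟩
    σ-series (suc n)                                     ∎
    where open ≡-Reasoning

-- In ∑ k qᵏ / (1 - qᵏ) the coefficient of qⁿ collects each divisor k of n once, and for n ≤ N no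
-- divisor of a positive n lies beyond the truncation.
eulerLogDerivative-σ : ∀ {n N} → n ≤ N → eulerLogDerivative N n ≡ -[1+ 23 ] * σ-series n
eulerLogDerivative-σ {zero} {zero}  _ = refl
eulerLogDerivative-σ {zero} {suc N} _ = cong (λ z → + 24 * - 0ℤ + z) (eulerLogDerivative-σ {zero} {N} z≤n)
eulerLogDerivative-σ {suc n} {N} n<N = trans (go N) (cong (-[1+ 23 ] *_) (divisorSum≤-≥ n<N))
  where
  open ≡-Reasoning
  lemma : ∀ x y → + 24 * - x + -[1+ 23 ] * y ≡ -[1+ 23 ] * (x + y)
  lemma = solve-∀
  go : ∀ N → eulerLogDerivative N (suc n) ≡ -[1+ 23 ] * + divisorSum≤ (suc n) N
  go zero    = refl
  go (suc N) = begin
    + 24 * - lambert (suc N) (suc n) + eulerLogDerivative N (suc n)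
      ≡⟨ cong (λ z → + 24 * - lambert (suc N) (suc n) + z) (go N) ⟩
    + 24 * - lambert (suc N) (suc n) + -[1+ 23 ] * + divisorSum≤ (suc n) N
      ≡⟨ lemma (lambert (suc N) (suc n)) (+ divisorSum≤ (suc n) N) ⟩
    -[1+ 23 ] * (lambert (suc N) (suc n) + + divisorSum≤ (suc n) N)
      ≡⟨ cong (-[1+ 23 ] *_) (divisorSum≤-suc n N) ⟨
    -[1+ 23 ] * + divisorSum≤ (suc n) (suc N) ∎

-- The passage to the limit is coefficientwise: the coefficient of qⁿ involves only coefficients of
-- index at most n, and there the truncations at n already agree with `∏∞ a` and `f`.
logDerivative-∏∞ : ∀ {a e f} → (∀ k → a k ≡1mod-q^ k) → (∀ k → a (suc k) hasLogDerivative e (suc k)) →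
                   (∀ {n N} → n ≤ N → ∑≤ N e n ≡ f n) → ∏∞ a hasLogDerivative f
logDerivative-∏∞ {a} {e} {f} a≡1 θa e-stable = logDerivative λ n → trans
  (θ≗ (logDerivative-∏≤ {a} {e} θa n) n)
  (sum-cong-≗ {suc n} λ i → cong₂ _*_
    (∏≤-stable a a≡1 (toℕ≤pred[n] i))
    (e-stable (ℕ.m∸n≤m n (toℕ i))))

logDerivative-eulerProduct²⁴ : ∏∞ eulerFactor²⁴ hasLogDerivative (-[1+ 23 ] · σ-series)
logDerivative-eulerProduct²⁴ = logDerivative-∏∞ {eulerFactor²⁴} {λ k → + 24 · ⊟ lambert k}
  eulerFactor²⁴-≡1 logDerivative-eulerFactor²⁴ eulerLogDerivative-σ

θτ : θ τ ≗ ChazyEquation.eisenstein₂ powerSeries σ-series ⊛ τ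
θτ = begin
  θ τ                                   ≈⟨ θ≗ (logDerivative-⊛ θq logDerivative-eulerProduct²⁴) ⟩
  τ ⊛ (const 1ℤ ⊞ (-[1+ 23 ] · σ-series))  ≈⟨ ⊛-cong {τ} ≗-refl (⊞-cong (≗-refl {const 1ℤ}) (≗-sym (const-⊛ -[1+ 23 ] σ-series))) ⟩
  τ ⊛ (const 1ℤ ⊞ const -[1+ 23 ] ⊛ σ-series)  ≈⟨ ⊛-comm τ (const 1ℤ ⊞ const -[1+ 23 ] ⊛ σ-series) ⟩
  (const 1ℤ ⊞ const -[1+ 23 ] ⊛ σ-series) ⊛ τ  ∎
  where
  open ≗-Reasoning
  θq : (q^ 1) hasLogDerivative (const 1ℤ)
  θq = logDerivative λ n → trans (θq^ 1 n) (trans (sym (const-⊛ 1ℤ (q^ 1) n)) (⊛-comm (const 1ℤ) (q^ 1) n))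

-- Sums over enumerated finite sets

private
  variable
    A B : Set
    P Q : Pred A 0ℓ
    xs ys : List A

∑∈ : List A → (A → ℤ) → ℤ
∑∈ []       f = 0ℤ
∑∈ (x ∷ xs) f = f x + ∑∈ xs f

∑∈-cong : ∀ (xs : List A) {f g : A → ℤ} → (∀ {x} → x ∈ xs → f x ≡ g x) → ∑∈ xs f ≡ ∑∈ xs g
∑∈-cong []       f≡g = refl
∑∈-cong (x ∷ xs) f≡g = cong₂ _+_ (f≡g (here refl)) (∑∈-cong xs (f≡g ∘ there))

∑∈-+ : ∀ (xs : List A) (f g : A → ℤ) → ∑∈ xs (λ x → f x + g x) ≡ ∑∈ xs f + ∑∈ xs g
∑∈-+ []       f g = refl
∑∈-+ (x ∷ xs) f g = trans (cong (λ z → f x + g x + z) (∑∈-+ xs f g)) (lemma (f x) (g x) (∑∈ xs f) (∑∈ xs g))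
  where
  lemma : ∀ a b c d → a + b + (c + d) ≡ a + c + (b + d)
  lemma = solve-∀

∑∈-*ˡ : ∀ c (xs : List A) (f : A → ℤ) → c * ∑∈ xs f ≡ ∑∈ xs (λ x → c * f x)
∑∈-*ˡ c []       f = ℤ.*-zeroʳ c
∑∈-*ˡ c (x ∷ xs) f = trans (ℤ.*-distribˡ-+ c (f x) (∑∈ xs f)) (cong (λ z → c * f x + z) (∑∈-*ˡ c xs f))

∑∈-++ : ∀ (xs ys : List A) f → ∑∈ (xs ++ ys) f ≡ ∑∈ xs f + ∑∈ ys f
∑∈-++ []       ys f = sym (ℤ.+-identityˡ (∑∈ ys f))
∑∈-++ (x ∷ xs) ys f = trans (cong (λ z → f x + z) (∑∈-++ xs ys f)) (sym (ℤ.+-assoc (f x) (∑∈ xs f) (∑∈ ys f)))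

∑∈-map : ∀ (g : A → B) xs f → ∑∈ (map g xs) f ≡ ∑∈ xs (f ∘ g)
∑∈-map g []       f = refl
∑∈-map g (x ∷ xs) f = cong (λ z → f (g x) + z) (∑∈-map g xs f)

∑∈-↭ : ∀ {xs ys : List A} (f : A → ℤ) → xs ↭ ys → ∑∈ xs f ≡ ∑∈ ys f
∑∈-↭ f ↭.refl          = refl
∑∈-↭ f (↭.prep x p)    = cong (λ z → f x + z) (∑∈-↭ f p)
∑∈-↭ {ys = y ∷ x ∷ ys} f (↭.swap x y p) = trans (cong (λ z → f x + (f y + z)) (∑∈-↭ f p)) (lemma (f x) (f y) (∑∈ ys f))
  where
  lemma : ∀ a b c → a + (b + c) ≡ b + (a + c)
  lemma = solve-∀
∑∈-↭ f (↭.trans p q)   = trans (∑∈-↭ f p) (∑∈-↭ f q)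

-- Two lists without repetitions that have the same members are permutations of each other, so a sum
-- depends only on the predicate. Reindexing then needs a bijection between predicates and no
-- control over the order of the lists.
record _enumerates_ (xs : List A) (P : Pred A 0ℓ) : Set where
  field
    unique   : Unique xs
    sound    : ∀ {x} → x ∈ xs → P x
    complete : ∀ {x} → P x → x ∈ xs


open _enumerates_

∑∈-enumeration : ∀ (f : A → ℤ) → xs enumerates P → ys enumerates P → ∑∈ xs f ≡ ∑∈ ys f
∑∈-enumeration f ex ey = ∑∈-↭ f (∼bag⇒↭ (unique∧set⇒bag (unique ex) (unique ey)
  (mk⇔ (complete ey ∘ sound ex) (complete ex ∘ sound ey))))

-- Injectivity is demanded on the members only: a map with truncated subtraction, such as `euclid`,
-- is injective just on the region where the subtraction is exact.
map-unique : ∀ (f : A → B) → (∀ {x y} → x ∈ xs → y ∈ xs → f x ≡ f y → x ≡ y) → Unique xs → Unique (map f xs)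
map-unique {xs = []}     f inj []         = []
map-unique {xs = x ∷ xs} f inj (x∉xs ∷ u) =
  All.tabulate (λ {z} z∈ fx≡z → let y , y∈ , z≡fy = ∈-map⁻ f z∈ in
    All.lookup x∉xs y∈ (inj (here refl) (there y∈) (trans fx≡z z≡fy)))
  ∷ map-unique f (λ x∈ y∈ → inj (there x∈) (there y∈)) u

∑∈-bijection : ∀ {P : Pred A 0ℓ} {Q : Pred B 0ℓ} → xs enumerates P → ys enumerates Q →
               (f : A → B) (g : B → A) →
               (∀ {x} → P x → Q (f x)) → (∀ {y} → Q y → P (g y)) →
               (∀ {x} → P x → g (f x) ≡ x) → (∀ {y} → Q y → f (g y) ≡ y) →
               {h : A → ℤ} {k : B → ℤ} → (∀ {x} → P x → h x ≡ k (f x)) → ∑∈ xs h ≡ ∑∈ ys k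
∑∈-bijection {xs = xs} {ys = ys} {Q = Q} ex ey f g P⇒Q Q⇒P gf fg {h} {k} h≡kf = begin
  ∑∈ xs h          ≡⟨ ∑∈-cong xs (h≡kf ∘ sound ex) ⟩
  ∑∈ xs (k ∘ f)    ≡⟨ ∑∈-map f xs k ⟨
  ∑∈ (map f xs) k  ≡⟨ ∑∈-enumeration k image ey ⟩
  ∑∈ ys k          ∎
  where
  open ≡-Reasoning
  image : map f xs enumerates Q
  image = record
    { unique   = map-unique f (λ x∈ y∈ fx≡fy →
        trans (sym (gf (sound ex x∈))) (trans (cong g fx≡fy) (gf (sound ex y∈)))) (unique ex)
    ; sound    = λ z∈ → let x , x∈ , z≡fx = ∈-map⁻ f z∈ in subst Q (sym z≡fx) (P⇒Q (sound ex x∈))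
    ; complete = λ Qy → subst (_∈ map f xs) (fg Qy) (∈-map⁺ f (complete ex (Q⇒P Qy)))
    }

filter-enumerates : (Q? : Decidable Q) → xs enumerates P → filter Q? xs enumerates (λ x → P x × Q x)
filter-enumerates Q? ex = record
  { unique   = Unique.filter⁺ Q? (unique ex)
  ; sound    = λ x∈ → let x∈xs , Qx = ∈-filter⁻ Q? x∈ in sound ex x∈xs , Qx
  ; complete = λ (Px , Qx) → ∈-filter⁺ Q? (complete ex Px) Qx
  }

enumerates-⇔ : (∀ {x} → P x → Q x) → (∀ {x} → Q x → P x) → xs enumerates P → xs enumerates Q
enumerates-⇔ P⇒Q Q⇒P ex = record
  { unique = unique ex ; sound = P⇒Q ∘ sound ex ; complete = complete ex ∘ Q⇒P }

×-enumerates : ∀ {P : Pred A 0ℓ} {Q : Pred B 0ℓ} → xs enumerates P → ys enumerates Q →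
               cartesianProduct xs ys enumerates (λ (x , y) → P x × Q y)
×-enumerates {xs = xs} {ys = ys} ex ey = record
  { unique   = Unique.cartesianProduct⁺ (unique ex) (unique ey)
  ; sound    = λ xy∈ → let x∈ , y∈ = ∈-cartesianProduct⁻ xs ys xy∈ in sound ex x∈ , sound ey y∈
  ; complete = λ (Px , Qy) → ∈-cartesianProduct⁺ (complete ex Px) (complete ey Qy)
  }

dependentProduct : List A → (A → List B) → List (A × B)
dependentProduct []       ys = []
dependentProduct (x ∷ xs) ys = map (x ,_) (ys x) ++ dependentProduct xs ys

∈-dependentProduct⁻ : ∀ (xs : List A) (ys : A → List B) {x y} →
                      (x , y) ∈ dependentProduct xs ys → x ∈ xs × y ∈ ys x
∈-dependentProduct⁻ (x ∷ xs) ys p with ∈-++⁻ (map (x ,_) (ys x)) p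
... | inj₁ q with _ , y∈ , refl ← ∈-map⁻ (x ,_) q = here refl , y∈
... | inj₂ q = let x∈ , y∈ = ∈-dependentProduct⁻ xs ys q in there x∈ , y∈

∈-dependentProduct⁺ : ∀ (xs : List A) (ys : A → List B) {x y} →
                      x ∈ xs → y ∈ ys x → (x , y) ∈ dependentProduct xs ys
∈-dependentProduct⁺ (x ∷ xs) ys (here refl) y∈ = ∈-++⁺ˡ (∈-map⁺ (x ,_) y∈)
∈-dependentProduct⁺ (x ∷ xs) ys (there x∈)  y∈ = ∈-++⁺ʳ (map (x ,_) (ys x)) (∈-dependentProduct⁺ xs ys x∈ y∈)

dependentProduct-unique : ∀ {xs : List A} {ys : A → List B} →
                          Unique xs → (∀ x → Unique (ys x)) → Unique (dependentProduct xs ys)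
dependentProduct-unique []         v = []
dependentProduct-unique {xs = x ∷ xs} {ys} (x∉xs ∷ u) v =
  Unique.++⁺ (Unique.map⁺ (λ { refl → refl }) (v x)) (dependentProduct-unique u v) disjoint
  where
  disjoint : ∀ {z} → ¬ (z ∈ map (x ,_) (ys x) × z ∈ dependentProduct xs ys)
  disjoint (p , q) with _ , _ , refl ← ∈-map⁻ (x ,_) p =
    All.lookup x∉xs (proj₁ (∈-dependentProduct⁻ xs ys q)) refl

dependentProduct-enumerates : ∀ {P : Pred A 0ℓ} {Q : A → Pred B 0ℓ} {ys : A → List B} →
  xs enumerates P → (∀ x → ys x enumerates Q x) →
  dependentProduct xs ys enumerates (λ (x , y) → P x × Q x y)
dependentProduct-enumerates {xs = xs} {ys = ys} ex ey = record
  { unique   = dependentProduct-unique (unique ex) (unique ∘ ey)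
  ; sound    = λ xy∈ → let x∈ , y∈ = ∈-dependentProduct⁻ xs ys xy∈ in sound ex x∈ , sound (ey _) y∈
  ; complete = λ (Px , Qy) → ∈-dependentProduct⁺ xs ys (complete ex Px) (complete (ey _) Qy)
  }

∑∈-dependentProduct : ∀ (xs : List A) (ys : A → List B) f →
  ∑∈ (dependentProduct xs ys) f ≡ ∑∈ xs (λ x → ∑∈ (ys x) (λ y → f (x , y)))
∑∈-dependentProduct []       ys f = refl
∑∈-dependentProduct (x ∷ xs) ys f = trans (∑∈-++ (map (x ,_) (ys x)) (dependentProduct xs ys) f)
  (cong₂ _+_ (∑∈-map (x ,_) (ys x) f) (∑∈-dependentProduct xs ys f))

module _ (f g : A → ℕ) where
  <-part ≡-part >-part : List A → List A
  <-part = filter (λ x → f x ℕ.<? g x)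
  ≡-part = filter (λ x → f x ℕ.≟ g x)
  >-part = filter (λ x → g x ℕ.<? f x)

  ∑∈-trichotomy : ∀ xs h → ∑∈ xs h ≡ ∑∈ (<-part xs) h + ∑∈ (≡-part xs) h + ∑∈ (>-part xs) h
  ∑∈-trichotomy []       h = refl
  ∑∈-trichotomy (x ∷ xs) h with ℕ.<-cmp (f x) (g x)
  ... | tri< a ¬b ¬c
    rewrite List.filter-accept (λ x → f x ℕ.<? g x) {x} {xs} a
          | List.filter-reject (λ x → f x ℕ.≟ g x) {x} {xs} ¬b
          | List.filter-reject (λ x → g x ℕ.<? f x) {x} {xs} ¬c
          | ∑∈-trichotomy xs h = lemma (h x) (∑∈ (<-part xs) h) (∑∈ (≡-part xs) h) (∑∈ (>-part xs) h)
    where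
    lemma : ∀ a b c d → a + (b + c + d) ≡ a + b + c + d
    lemma = solve-∀
  ... | tri≈ ¬a b ¬c
    rewrite List.filter-reject (λ x → f x ℕ.<? g x) {x} {xs} ¬a
          | List.filter-accept (λ x → f x ℕ.≟ g x) {x} {xs} b
          | List.filter-reject (λ x → g x ℕ.<? f x) {x} {xs} ¬c
          | ∑∈-trichotomy xs h = lemma (h x) (∑∈ (<-part xs) h) (∑∈ (≡-part xs) h) (∑∈ (>-part xs) h)
    where
    lemma : ∀ a b c d → a + (b + c + d) ≡ b + (a + c) + d
    lemma = solve-∀
  ... | tri> ¬a ¬b c
    rewrite List.filter-reject (λ x → f x ℕ.<? g x) {x} {xs} ¬a
          | List.filter-reject (λ x → f x ℕ.≟ g x) {x} {xs} ¬b
          | List.filter-accept (λ x → g x ℕ.<? f x) {x} {xs} c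
          | ∑∈-trichotomy xs h = lemma (h x) (∑∈ (<-part xs) h) (∑∈ (≡-part xs) h) (∑∈ (>-part xs) h)
    where
    lemma : ∀ a b c d → a + (b + c + d) ≡ b + c + (a + d)
    lemma = solve-∀

[1⋯_] : ℕ → List ℕ
[1⋯ n ] = applyUpTo suc n

[1⋯]-enumerates : ∀ n → [1⋯ n ] enumerates (λ i → 0 < i × i ≤ n)
[1⋯]-enumerates n = record
  { unique   = Unique.applyUpTo⁺₁ suc n (λ i<j _ → ℕ.<⇒≢ i<j ∘ ℕ.suc-injective)
  ; sound    = λ i∈ → let j , j<n , i≡1+j = ∈-applyUpTo⁻ suc i∈ in
                 subst (0 <_) (sym i≡1+j) (s≤s z≤n) , subst (_≤ n) (sym i≡1+j) j<n
  ; complete = λ { {suc i} (_ , i<n) → ∈-applyUpTo⁺ suc i<n }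
  }

∑∈-[1⋯suc] : ∀ n f → ∑∈ [1⋯ suc n ] f ≡ ∑∈ [1⋯ n ] f + f (suc n)
∑∈-[1⋯suc] n f = trans (cong (λ xs → ∑∈ xs f) (sym (List.applyUpTo-∷ʳ suc n)))
  (trans (∑∈-++ [1⋯ n ] (suc n ∷ []) f) (cong (λ z → ∑∈ [1⋯ n ] f + z) (ℤ.+-identityʳ (f (suc n)))))

-- The equation a x + b y = n

Factorisation : ℕ → Pred (ℕ × ℕ) 0ℓ
Factorisation n (a , x) = 0 < a × 0 < x × a ℕ.* x ≡ n

factorisations : ℕ → List (ℕ × ℕ)
factorisations n = filter (λ (a , x) → a ℕ.* x ℕ.≟ n) (cartesianProduct [1⋯ n ] [1⋯ n ])

m≤m*n : ∀ {m n} → 0 < n → m ≤ m ℕ.* n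
m≤m*n {m} {n} 0<n = ℕ.m≤m*n m n {{ℕ.>-nonZero 0<n}}

m≤n*m : ∀ {m n} → 0 < n → m ≤ n ℕ.* m
m≤n*m {m} {n} 0<n = ℕ.m≤n*m m n {{ℕ.>-nonZero 0<n}}

factorisations-enumerates : ∀ n → factorisations n enumerates Factorisation n
factorisations-enumerates n = enumerates-⇔
  (λ (((0<a , _) , (0<x , _)) , ax≡n) → 0<a , 0<x , ax≡n)
  (λ { (0<a , 0<x , refl) → ((0<a , m≤m*n 0<x) , (0<x , m≤n*m 0<a)) , refl })
  (filter-enumerates (λ (a , x) → a ℕ.* x ℕ.≟ n)
    (×-enumerates ([1⋯]-enumerates n) ([1⋯]-enumerates n)))

Quadruple : Set
Quadruple = (ℕ × ℕ) × (ℕ × ℕ)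

Positive : Pred Quadruple 0ℓ
Positive ((a , x) , (b , y)) = (0 < a × 0 < x) × (0 < b × 0 < y)

Solution : ℕ → Pred Quadruple 0ℓ
Solution n q@((a , x) , (b , y)) = Positive q × a ℕ.* x ℕ.+ b ℕ.* y ≡ n

solutions : ℕ → List Quadruple
solutions n = filter (λ ((a , x) , (b , y)) → a ℕ.* x ℕ.+ b ℕ.* y ℕ.≟ n)
  (cartesianProduct (cartesianProduct [1⋯ n ] [1⋯ n ]) (cartesianProduct [1⋯ n ] [1⋯ n ]))

solutions-enumerates : ∀ n → solutions n enumerates Solution n
solutions-enumerates n = enumerates-⇔
  (λ ((((0<a , _) , (0<x , _)) , ((0<b , _) , (0<y , _))) , eq) → ((0<a , 0<x) , (0<b , 0<y)) , eq)
  (λ { {(a , x) , (b , y)} (((0<a , 0<x) , (0<b , 0<y)) , refl) →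
      let ax≤ = ℕ.m≤m+n (a ℕ.* x) (b ℕ.* y)
          by≤ = ℕ.m≤n+m (b ℕ.* y) (a ℕ.* x)
      in ( ((0<a , ℕ.≤-trans (m≤m*n 0<x) ax≤) , (0<x , ℕ.≤-trans (m≤n*m 0<a) ax≤))
         , ((0<b , ℕ.≤-trans (m≤m*n 0<y) by≤) , (0<y , ℕ.≤-trans (m≤n*m 0<b) by≤)) ) , refl })
  (filter-enumerates (λ ((a , x) , (b , y)) → a ℕ.* x ℕ.+ b ℕ.* y ℕ.≟ n)
    (×-enumerates (×-enumerates box box) (×-enumerates box box)))
  where
  box = [1⋯]-enumerates n

-- The arguments are in the order a, b, x, y.
⟪_⟫ : (ℤ → ℤ → ℤ → ℤ → ℤ) → Quadruple → ℤ
⟪ f ⟫ ((a , x) , (b , y)) = f (+ a) (+ b) (+ x) (+ y)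

swap : Quadruple → Quadruple
swap ((a , x) , (b , y)) = (x , a) , (y , b)

-- Transposing both factorisations preserves a x + b y, so a sum depends only on f(a, b, x, y) +
-- f(x, y, a, b). `∑-solutions` uses this freedom to trade `p` for an `e` that changes sign under
-- `euclid`.
∑-swap : ∀ n f → ∑∈ (solutions n) ⟪ f ⟫ ≡ ∑∈ (solutions n) ⟪ (λ a b x y → f x y a b) ⟫
∑-swap n f = ∑∈-bijection (solutions-enumerates n) (solutions-enumerates n) swap swap
  (λ {q} → preserves {q}) (λ {q} → preserves {q}) (λ _ → refl) (λ _ → refl) (λ _ → refl)
  where
  preserves : ∀ {q} → Solution n q → Solution n (swap q)
  preserves {(a , x) , (b , y)} (((0<a , 0<x) , (0<b , 0<y)) , eq) =
    ((0<x , 0<a) , (0<y , 0<b)) , trans (cong₂ ℕ._+_ (ℕ.*-comm x a) (ℕ.*-comm y b)) eq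

pos-∸ : ∀ {m n} → n ≤ m → + (m ∸ n) ≡ + m - + n
pos-∸ {m} {n} n≤m = sym (trans (ℤ.m-n≡m⊖n m n) (ℤ.⊖-≥ n≤m))

Left Right : Quadruple → ℕ
Left  ((a , x) , (b , y)) = a
Right ((a , x) , (b , y)) = b

-- Euclid's step (a, b) ↦ (a, b - a) preserves a x + b y when paired with (x, y) ↦ (x + y, y).
-- Transposing afterwards puts x + y and y in the places of a and b; since x + y > y always, the
-- image is all of the region a > b.
euclid : Quadruple → Quadruple
euclid ((a , x) , (b , y)) = (x ℕ.+ y , a) , (y , b ∸ a)

euclid⁻¹ : Quadruple → Quadruple
euclid⁻¹ ((a , x) , (b , y)) = (x , a ∸ b) , (x ℕ.+ y , b)

module _ (n : ℕ) where
  private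
    below above : List Quadruple
    below = <-part Left Right (solutions n)
    above = >-part Left Right (solutions n)

    below-enumerates : below enumerates (λ q → Solution n q × Left q < Right q)
    below-enumerates = filter-enumerates (λ q → Left q ℕ.<? Right q) (solutions-enumerates n)

    above-enumerates : above enumerates (λ q → Solution n q × Right q < Left q)
    above-enumerates = filter-enumerates (λ q → Right q ℕ.<? Left q) (solutions-enumerates n)

  ∑-euclid : ∀ f g → (∀ a b x y → f a b x y ≡ g (x + y) y a (b - a)) →
             ∑∈ below ⟪ f ⟫ ≡ ∑∈ above ⟪ g ⟫
  ∑-euclid f g f≡g = ∑∈-bijection below-enumerates above-enumerates euclid euclid⁻¹
    (λ {q} → to {q}) (λ {q} → from {q}) (λ {q} → left {q}) (λ {q} → right {q}) (λ {q} → value {q})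
    where
    open ≡-Reasoning
    to : ∀ {q} → Solution n q × Left q < Right q → Solution n (euclid q) × Right (euclid q) < Left (euclid q)
    to {(a , x) , (b , y)} ((((0<a , 0<x) , (0<b , 0<y)) , eq) , a<b) with ℕ.m≤n⇒∃[o]m+o≡n (ℕ.<⇒≤ a<b)
    ... | c , refl = (((ℕ.m≤n⇒m≤n+o y 0<x , 0<a) , (0<y , ℕ.m<n⇒0<n∸m a<b)) , (begin
      (x ℕ.+ y) ℕ.* a ℕ.+ y ℕ.* (a ℕ.+ c ∸ a)  ≡⟨ cong (λ z → (x ℕ.+ y) ℕ.* a ℕ.+ y ℕ.* z) (ℕ.m+n∸m≡n a c) ⟩
      (x ℕ.+ y) ℕ.* a ℕ.+ y ℕ.* c              ≡⟨ lemma a c x y ⟩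
      a ℕ.* x ℕ.+ (a ℕ.+ c) ℕ.* y              ≡⟨ eq ⟩
      n                                        ∎)) , ℕ.m<n+m y 0<x
      where
      lemma : ∀ a c x y → (x ℕ.+ y) ℕ.* a ℕ.+ y ℕ.* c ≡ a ℕ.* x ℕ.+ (a ℕ.+ c) ℕ.* y
      lemma = ℕ-solve-∀
    from : ∀ {q} → Solution n q × Right q < Left q → Solution n (euclid⁻¹ q) × Left (euclid⁻¹ q) < Right (euclid⁻¹ q)
    from {(a , x) , (b , y)} ((((0<a , 0<x) , (0<b , 0<y)) , eq) , b<a) with ℕ.m≤n⇒∃[o]m+o≡n (ℕ.<⇒≤ b<a)
    ... | c , refl = (((0<x , ℕ.m<n⇒0<n∸m b<a) , (ℕ.m≤n⇒m≤n+o y 0<x , 0<b)) , (begin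
      x ℕ.* (b ℕ.+ c ∸ b) ℕ.+ (x ℕ.+ y) ℕ.* b  ≡⟨ cong (λ z → x ℕ.* z ℕ.+ (x ℕ.+ y) ℕ.* b) (ℕ.m+n∸m≡n b c) ⟩
      x ℕ.* c ℕ.+ (x ℕ.+ y) ℕ.* b              ≡⟨ lemma b c x y ⟩
      (b ℕ.+ c) ℕ.* x ℕ.+ b ℕ.* y              ≡⟨ eq ⟩
      n                                        ∎)) , ℕ.m<m+n x 0<y
      where
      lemma : ∀ b c x y → x ℕ.* c ℕ.+ (x ℕ.+ y) ℕ.* b ≡ (b ℕ.+ c) ℕ.* x ℕ.+ b ℕ.* y
      lemma = ℕ-solve-∀
    left : ∀ {q} → Solution n q × Left q < Right q → euclid⁻¹ (euclid q) ≡ q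
    left {(a , x) , (b , y)} (_ , a<b) = cong₂ (λ u v → (a , u) , (v , y)) (ℕ.m+n∸n≡m x y) (ℕ.m+[n∸m]≡n (ℕ.<⇒≤ a<b))
    right : ∀ {q} → Solution n q × Right q < Left q → euclid (euclid⁻¹ q) ≡ q
    right {(a , x) , (b , y)} (_ , b<a) = cong₂ (λ u v → (u , x) , (b , v)) (ℕ.m∸n+n≡m (ℕ.<⇒≤ b<a)) (ℕ.m+n∸m≡n x y)
    value : ∀ {q} → Solution n q × Left q < Right q → ⟪ f ⟫ q ≡ ⟪ g ⟫ (euclid q)
    value {(a , x) , (b , y)} (_ , a<b) = trans (f≡g (+ a) (+ b) (+ x) (+ y))
      (cong (g (+ x + + y) (+ y) (+ a)) (sym (pos-∸ (ℕ.<⇒≤ a<b))))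

  private
    diagonal : List Quadruple
    diagonal = ≡-part Left Right (solutions n)

    diagonalParameters : List ((ℕ × ℕ) × ℕ)
    diagonalParameters = dependentProduct (factorisations n) (λ (a , d) → [1⋯ d ∸ 1 ])

  -- For a = b the equation reads a (x + y) = n, so a solution is a factorisation n = a d together
  -- with a splitting of d into x and d - x.
  ∑-diagonal : ∀ f → ∑∈ diagonal ⟪ f ⟫ ≡
    ∑∈ (factorisations n) (λ (a , d) → ∑∈ [1⋯ d ∸ 1 ] (λ x → f (+ a) (+ a) (+ x) (+ (d ∸ x))))
  ∑-diagonal f = trans
    (∑∈-bijection
      (filter-enumerates (λ q → Left q ℕ.≟ Right q) (solutions-enumerates n))
      (dependentProduct-enumerates (factorisations-enumerates n) (λ (a , d) → [1⋯]-enumerates (d ∸ 1)))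
      (λ ((a , x) , (b , y)) → (a , x ℕ.+ y) , x)
      (λ ((a , d) , x) → (a , x) , (a , d ∸ x))
      (λ { {(a , x) , (b , y)} ((((0<a , 0<x) , (0<b , 0<y)) , eq) , refl) →
             (0<a , ℕ.m≤n⇒m≤n+o y 0<x , trans (ℕ.*-distribˡ-+ a x y) eq)
           , (0<x , x≤x+y∸1 x 0<y) })
      (λ { {(a , d) , x} ((0<a , 0<d , ad≡n) , (0<x , x≤d∸1)) →
             (((0<a , 0<x) , (0<a , ℕ.m<n⇒0<n∸m (x<d 0<d x≤d∸1)))
             , trans (sym (ℕ.*-distribˡ-+ a x (d ∸ x)))
                 (trans (cong (a ℕ.*_) (ℕ.m+[n∸m]≡n (ℕ.<⇒≤ (x<d 0<d x≤d∸1)))) ad≡n))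
           , refl })
      (λ { {(a , x) , (b , y)} (_ , refl) → cong (λ z → (a , x) , (a , z)) (ℕ.m+n∸m≡n x y) })
      (λ { {(a , d) , x} ((_ , 0<d , _) , (_ , x≤d∸1)) →
           cong (λ z → (a , z) , x) (ℕ.m+[n∸m]≡n (ℕ.<⇒≤ (x<d 0<d x≤d∸1))) })
      (λ { {(a , x) , (b , y)} (_ , refl) → cong (λ z → f (+ a) (+ a) (+ x) (+ z)) (sym (ℕ.m+n∸m≡n x y)) }))
    (∑∈-dependentProduct (factorisations n) (λ (a , d) → [1⋯ d ∸ 1 ]) _)
    where
    x<d : ∀ {x d} → 0 < d → x ≤ d ∸ 1 → x < d
    x<d {d = suc d} _ x≤d = s≤s x≤d
    x≤x+y∸1 : ∀ x {y} → 0 < y → x ≤ x ℕ.+ y ∸ 1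
    x≤x+y∸1 x {suc y} _ rewrite ℕ.+-suc x y = ℕ.m≤m+n x y

  -- By anti, the solutions with a < b and those with a > b contribute opposite amounts to ∑ e.
  ∑-solutions : ∀ e p → (∀ a b x y → - e a b x y ≡ e (x + y) y a (b - a)) →
    (∀ a b x y → e a b x y + e x y a b ≡ p a b x y + p x y a b) →
    ∑∈ (solutions n) ⟪ p ⟫ ≡
    ∑∈ (factorisations n) (λ (a , d) → ∑∈ [1⋯ d ∸ 1 ] (λ x → e (+ a) (+ a) (+ x) (+ (d ∸ x))))
  ∑-solutions e p anti e∼p = trans p≡e (trans (∑∈-trichotomy Left Right (solutions n) ⟪ e ⟫) (trans cancel (∑-diagonal e)))
    where
    double-injective : ∀ u v → u + u ≡ v + v → u ≡ v
    double-injective u v eq = ℤ.*-cancelˡ-≡ (+ 2) u v (trans (double u) (trans eq (sym (double v))))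
      where
      double : ∀ u → + 2 * u ≡ u + u
      double = solve-∀
    symmetrise : ∀ f → ∑∈ (solutions n) ⟪ f ⟫ + ∑∈ (solutions n) ⟪ f ⟫ ≡
                       ∑∈ (solutions n) ⟪ (λ a b x y → f a b x y + f x y a b) ⟫
    symmetrise f = trans (cong (λ z → ∑∈ (solutions n) ⟪ f ⟫ + z) (∑-swap n f))
      (sym (∑∈-+ (solutions n) ⟪ f ⟫ ⟪ (λ a b x y → f x y a b) ⟫))
    p≡e : ∑∈ (solutions n) ⟪ p ⟫ ≡ ∑∈ (solutions n) ⟪ e ⟫
    p≡e = double-injective _ _ (trans (symmetrise p) (trans
      (∑∈-cong (solutions n) (λ { {(a , x) , (b , y)} _ → sym (e∼p (+ a) (+ b) (+ x) (+ y)) }))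
      (sym (symmetrise e))))
    above≡-below : ∑∈ above ⟪ e ⟫ ≡ -[1+ 0 ] * ∑∈ below ⟪ e ⟫
    above≡-below = trans (sym (∑-euclid (λ a b x y → -[1+ 0 ] * e a b x y) e
      (λ a b x y → trans (ℤ.-1*i≡-i (e a b x y)) (anti a b x y)))) (sym (∑∈-*ˡ -[1+ 0 ] below ⟪ e ⟫))
    cancel : ∑∈ below ⟪ e ⟫ + ∑∈ diagonal ⟪ e ⟫ + ∑∈ above ⟪ e ⟫ ≡ ∑∈ diagonal ⟪ e ⟫
    cancel = trans (cong (λ z → ∑∈ below ⟪ e ⟫ + ∑∈ diagonal ⟪ e ⟫ + z) above≡-below)
                   (lemma (∑∈ below ⟪ e ⟫) (∑∈ diagonal ⟪ e ⟫))
      where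
      lemma : ∀ u v → u + v + -[1+ 0 ] * u ≡ v
      lemma = solve-∀

-- Convolution sums of σ

∑∈-*ʳ : ∀ {A : Set} c (xs : List A) (f : A → ℤ) → ∑∈ xs f * c ≡ ∑∈ xs (λ x → f x * c)
∑∈-*ʳ c xs f = trans (ℤ.*-comm (∑∈ xs f) c)
  (trans (∑∈-*ˡ c xs f) (∑∈-cong xs (λ {x} _ → ℤ.*-comm c (f x))))

∑-Fin : ∀ n (g : ℕ → ℕ) f → ∑[ i < n ] f (g (toℕ i)) ≡ ∑∈ (applyUpTo g n) f
∑-Fin zero    g f = refl
∑-Fin (suc n) g f = cong (λ z → f (g 0) + z) (∑-Fin n (g ∘ suc) f)

∑∈-factorisations-swap : ∀ n (f : ℕ → ℕ → ℤ) →
  ∑∈ (factorisations n) (λ (a , d) → f a d) ≡ ∑∈ (factorisations n) (λ (a , d) → f d a)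
∑∈-factorisations-swap n f = ∑∈-bijection (factorisations-enumerates n) (factorisations-enumerates n)
  (λ (a , d) → d , a) (λ (a , d) → d , a)
  (λ {p} → preserves {p}) (λ {p} → preserves {p}) (λ _ → refl) (λ _ → refl) (λ _ → refl)
  where
  preserves : ∀ {p} → Factorisation n p → Factorisation n (proj₂ p , proj₁ p)
  preserves {a , d} (0<a , 0<d , ad≡n) = 0<d , 0<a , trans (ℕ.*-comm d a) ad≡n

∑∈-factorisations-separate : ∀ n (u v : ℕ → ℤ) →
  ∑∈ (factorisations n) (λ (a , d) → u d + v a) ≡ ∑∈ (factorisations n) (λ (a , d) → u a + v a)
∑∈-factorisations-separate n u v = begin
  ∑∈ F (λ (a , d) → u d + v a)                        ≡⟨ ∑∈-+ F (λ (a , d) → u d) (λ (a , d) → v a) ⟩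
  ∑∈ F (λ (a , d) → u d) + ∑∈ F (λ (a , d) → v a)     ≡⟨ cong (_+ ∑∈ F (λ (a , d) → v a)) (∑∈-factorisations-swap n (λ a d → u d)) ⟩
  ∑∈ F (λ (a , d) → u a) + ∑∈ F (λ (a , d) → v a)     ≡⟨ ∑∈-+ F (λ (a , d) → u a) (λ (a , d) → v a) ⟨
  ∑∈ F (λ (a , d) → u a + v a)                        ∎
  where
  open ≡-Reasoning
  F = factorisations n

pos-sum : ∀ (f : ℕ → ℕ) xs → + ListAction.sum (map f xs) ≡ ∑∈ xs (λ x → + f x)
pos-sum f []       = refl
pos-sum f (x ∷ xs) = cong (λ z → + f x + z) (pos-sum f xs)

σ-factorisations : ∀ k n → + σ k n ≡ ∑∈ (factorisations n) (λ (a , d) → + (a ℕ.^ k))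
σ-factorisations k n = trans (pos-sum (ℕ._^ k) (divisors n)) (sym
  (∑∈-bijection (factorisations-enumerates n)
    (filter-enumerates (_∣? n) ([1⋯]-enumerates n))
    proj₁ cofactor
    (λ { {a , d} (0<a , 0<d , refl) → (0<a , m≤m*n 0<d) , m∣m*n d })
    (λ { {suc d} ((0<d , d≤n) , d∣n) → 0<d , m≥n⇒m/n>0 d≤n , m*[n/m]≡n d∣n })
    (λ { {suc a , d} (0<a , 0<d , refl) → cong (suc a ,_) (trans (cong (ℕ._/ suc a) (ℕ.*-comm (suc a) d)) (m*n/n≡m d (suc a))) })
    (λ { {suc d} _ → refl })
    (λ _ → refl)))
  where
  cofactor : ℕ → ℕ × ℕ
  cofactor zero      = 0 , 0
  cofactor d@(suc _) = d , n ℕ./ d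

-- The kernel receives both parts m and k = n - m. Exchanging them is then a symmetry, and a product
-- of derivatives of s corresponds to a monomial in m and k.
convolution : ℕ → (ℤ → ℤ → ℤ) → ℤ
convolution n g = ∑∈ [1⋯ n ∸ 1 ] (λ m → g (+ m) (+ (n ∸ m)) * + σ 1 m * + σ 1 (n ∸ m))

m<n : ∀ {m n} → 0 < m → m ≤ n ∸ 1 → m < n
m<n {n = zero}  (s≤s z≤n) ()
m<n {n = suc n} _   m≤n = s≤s m≤n

-- Expand σ(m) as the sum of a over a x = m, and σ(n - m) as the sum of b over b y = n - m. The
-- index m = a x can be recovered from the quadruple.
convolution-solutions : ∀ n g → convolution n g ≡ ∑∈ (solutions n) ⟪ (λ a b x y → g (a * x) (b * y) * a * b) ⟫
convolution-solutions n g = begin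
  convolution n g
    ≡⟨ ∑∈-cong [1⋯ n ∸ 1 ] (λ {m} _ → expand m) ⟩
  ∑∈ [1⋯ n ∸ 1 ] (λ m → ∑∈ (dependentProduct (factorisations m) (λ _ → factorisations (n ∸ m)))
    (λ { ((a , x) , (b , y)) → g (+ m) (+ (n ∸ m)) * + a * + b }))
    ≡⟨ ∑∈-dependentProduct [1⋯ n ∸ 1 ] (λ m → dependentProduct (factorisations m) (λ _ → factorisations (n ∸ m)))
         (λ { (m , ((a , x) , (b , y))) → g (+ m) (+ (n ∸ m)) * + a * + b }) ⟨
  ∑∈ (dependentProduct [1⋯ n ∸ 1 ] (λ m → dependentProduct (factorisations m) (λ _ → factorisations (n ∸ m))))
    (λ { (m , ((a , x) , (b , y))) → g (+ m) (+ (n ∸ m)) * + a * + b })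
    ≡⟨ ∑∈-bijection
         (dependentProduct-enumerates ([1⋯]-enumerates (n ∸ 1))
           (λ m → dependentProduct-enumerates (factorisations-enumerates m) (λ _ → factorisations-enumerates (n ∸ m))))
         (solutions-enumerates n)
         proj₂ (λ { ((a , x) , (b , y)) → a ℕ.* x , ((a , x) , (b , y)) })
         (λ { {m , ((a , x) , (b , y))} ((0<m , m≤n∸1) , ((0<a , 0<x , ax≡m) , (0<b , 0<y , by≡n∸m))) →
              ((0<a , 0<x) , (0<b , 0<y)) ,
              trans (cong₂ ℕ._+_ ax≡m by≡n∸m) (ℕ.m+[n∸m]≡n (ℕ.<⇒≤ (m<n 0<m m≤n∸1))) })
         (λ { {(a , x) , (b , y)} (((0<a , 0<x) , (0<b , 0<y)) , refl) →
              (ℕ.*-mono-≤ 0<a 0<x , ℕ.pred-mono-≤ (ℕ.m<m+n (a ℕ.* x) (ℕ.*-mono-≤ 0<b 0<y))) ,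
              ((0<a , 0<x , refl) , (0<b , 0<y , sym (ℕ.m+n∸m≡n (a ℕ.* x) (b ℕ.* y)))) })
         (λ { {m , ((a , x) , (b , y))} (_ , ((_ , _ , ax≡m) , _)) → cong (_, ((a , x) , (b , y))) ax≡m })
         (λ _ → refl)
         (λ { {m , ((a , x) , (b , y))} (_ , ((_ , _ , ax≡m) , (_ , _ , by≡n∸m))) →
              cong₂ (λ u v → g u v * + a * + b)
                (trans (cong +_ (sym ax≡m)) (ℤ.pos-* a x)) (trans (cong +_ (sym by≡n∸m)) (ℤ.pos-* b y)) }) ⟩
  ∑∈ (solutions n) ⟪ (λ a b x y → g (a * x) (b * y) * a * b) ⟫ ∎
  where
  open ≡-Reasoning
  σ₁ : ∀ n → + σ 1 n ≡ ∑∈ (factorisations n) (λ (a , d) → + a)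
  σ₁ n = trans (σ-factorisations 1 n) (∑∈-cong (factorisations n) (λ {(a , d)} _ → cong +_ (ℕ.*-identityʳ a)))
  expand : ∀ m → g (+ m) (+ (n ∸ m)) * + σ 1 m * + σ 1 (n ∸ m) ≡
    ∑∈ (dependentProduct (factorisations m) (λ _ → factorisations (n ∸ m)))
       (λ { ((a , x) , (b , y)) → g (+ m) (+ (n ∸ m)) * + a * + b })
  expand m = begin
    c * + σ 1 m * + σ 1 (n ∸ m)
      ≡⟨ cong₂ (λ u v → c * u * v) (σ₁ m) (σ₁ (n ∸ m)) ⟩
    c * ∑∈ F (λ (a , x) → + a) * G
      ≡⟨ cong (_* G) (∑∈-*ˡ c F (λ (a , x) → + a)) ⟩
    ∑∈ F (λ (a , x) → c * + a) * G
      ≡⟨ ∑∈-*ʳ G F (λ (a , x) → c * + a) ⟩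
    ∑∈ F (λ (a , x) → c * + a * G)
      ≡⟨ ∑∈-cong F (λ { {a , x} _ → ∑∈-*ˡ (c * + a) (factorisations (n ∸ m)) (λ (b , y) → + b) }) ⟩
    ∑∈ F (λ (a , x) → ∑∈ (factorisations (n ∸ m)) (λ (b , y) → c * + a * + b))
      ≡⟨ ∑∈-dependentProduct F (λ _ → factorisations (n ∸ m)) _ ⟨
    _ ∎
    where
    c = g (+ m) (+ (n ∸ m))
    F = factorisations m
    G = ∑∈ (factorisations (n ∸ m)) (λ (b , y) → + b)

open +-*-Solver using (Polynomial; solve; con; _:=_; _:+_; _:*_; _:-_; :-_)

-- The factor 6 clears the denominator in ∑ x (d - x) = (d³ - d) / 6.
6∑-quadratic : ∀ α β d → 0 < d →
  + 6 * ∑∈ [1⋯ d ∸ 1 ] (λ x → α + β * (+ x * + (d ∸ x)))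
    ≡ + 6 * α * (+ d - 1ℤ) + β * (+ d * + d * + d - + d)
6∑-quadratic α β (suc k) _ = begin
  + 6 * ∑∈ [1⋯ k ] (λ x → α + β * (+ x * + (suc k ∸ x)))
    ≡⟨ cong (+ 6 *_) (∑∈-cong [1⋯ k ] (λ {x} x∈ → cong (λ z → α + β * (+ x * z))
         (pos-∸ (ℕ.m≤n⇒m≤1+n (proj₂ (sound ([1⋯]-enumerates k) x∈)))))) ⟩
  + 6 * ∑∈ [1⋯ k ] (λ x → α + β * (+ x * (+ suc k - + x)))
    ≡⟨ partial (+ suc k) k ⟩
  + 6 * α * + k + β * (+ 3 * + suc k * (+ k * (1ℤ + + k)) - + k * (1ℤ + + k) * (1ℤ + + 2 * + k))
    ≡⟨ lemma α β (+ k) ⟩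
  + 6 * α * (+ suc k - 1ℤ) + β * (+ suc k * + suc k * + suc k - + suc k) ∎
  where
  open ≡-Reasoning
  lemma : ∀ α β k → + 6 * α * k + β * (+ 3 * (1ℤ + k) * (k * (1ℤ + k)) - k * (1ℤ + k) * (1ℤ + + 2 * k))
    ≡ + 6 * α * (1ℤ + k - 1ℤ) + β * ((1ℤ + k) * (1ℤ + k) * (1ℤ + k) - (1ℤ + k))
  lemma = solve-∀
  step : ∀ α β D k → (+ 6 * α * k + β * (+ 3 * D * (k * (1ℤ + k)) - k * (1ℤ + k) * (1ℤ + + 2 * k)))
      + + 6 * (α + β * ((1ℤ + k) * (D - (1ℤ + k))))
    ≡ + 6 * α * (1ℤ + k) + β * (+ 3 * D * ((1ℤ + k) * (1ℤ + (1ℤ + k))) - (1ℤ + k) * (1ℤ + (1ℤ + k)) * (1ℤ + + 2 * (1ℤ + k)))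
  step = solve-∀
  base : ∀ α β D → + 6 * 0ℤ ≡ + 6 * α * 0ℤ + β * (+ 3 * D * (0ℤ * (1ℤ + 0ℤ)) - 0ℤ * (1ℤ + 0ℤ) * (1ℤ + + 2 * 0ℤ))
  base = solve-∀
  -- The summand contains the final d, so for the induction `D` is kept apart from the upper limit
  -- `k`: 6 ∑ x (D - x) = 3 D k (k + 1) - k (k + 1) (2 k + 1).
  partial : ∀ D k → + 6 * ∑∈ [1⋯ k ] (λ x → α + β * (+ x * (D - + x))) ≡
    + 6 * α * + k + β * (+ 3 * D * (+ k * (1ℤ + + k)) - + k * (1ℤ + + k) * (1ℤ + + 2 * + k))
  partial D zero    = base α β D
  partial D (suc k) = begin
    + 6 * ∑∈ [1⋯ suc k ] f                   ≡⟨ cong (+ 6 *_) (∑∈-[1⋯suc] k f) ⟩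
    + 6 * (∑∈ [1⋯ k ] f + f (suc k))         ≡⟨ ℤ.*-distribˡ-+ (+ 6) (∑∈ [1⋯ k ] f) (f (suc k)) ⟩
    + 6 * ∑∈ [1⋯ k ] f + + 6 * f (suc k)     ≡⟨ cong (_+ + 6 * f (suc k)) (partial D k) ⟩
    _                                        ≡⟨ step α β D (+ k) ⟩
    _                                        ∎
    where
    f : ℕ → ℤ
    f x = α + β * (+ x * (D - + x))

-- On the diagonal `e` depends on x and y only through d = x + y and, affinely, through x y, so the
-- sum over x has a closed form. The relation n = a d must then remove the mixed monomials. What
-- remains is a function of d plus a function of a, and the symmetry of factorisations turns both
-- into divisor sums in a.
6∑-solutions : ∀ n e p (α β : ℤ → ℤ → ℤ) (u v : ℤ → ℤ) →
  (∀ a b x y → - e a b x y ≡ e (x + y) y a (b - a)) →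
  (∀ a b x y → e a b x y + e x y a b ≡ p a b x y + p x y a b) →
  (∀ a x y → e a a x y ≡ α a (x + y) + β a (x + y) * (x * y)) →
  (∀ {a d} → + n ≡ a * d → + 6 * α a d * (d - 1ℤ) + β a d * (d * d * d - d) ≡ u d + v a) →
  + 6 * ∑∈ (solutions n) ⟪ p ⟫ ≡ ∑∈ (factorisations n) (λ (a , d) → u (+ a) + v (+ a))
6∑-solutions n e p α β u v anti e∼p diagonal separate = begin
  + 6 * ∑∈ (solutions n) ⟪ p ⟫
    ≡⟨ cong (+ 6 *_) (∑-solutions n e p anti e∼p) ⟩
  + 6 * ∑∈ F (λ (a , d) → ∑∈ [1⋯ d ∸ 1 ] (λ x → e (+ a) (+ a) (+ x) (+ (d ∸ x))))
    ≡⟨ ∑∈-*ˡ (+ 6) F _ ⟩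
  ∑∈ F (λ (a , d) → + 6 * ∑∈ [1⋯ d ∸ 1 ] (λ x → e (+ a) (+ a) (+ x) (+ (d ∸ x))))
    ≡⟨ ∑∈-cong F (λ { {a , d} ad∈ → inner (sound (factorisations-enumerates n) ad∈) }) ⟩
  ∑∈ F (λ (a , d) → u (+ d) + v (+ a))
    ≡⟨ ∑∈-factorisations-separate n (λ d → u (+ d)) (λ a → v (+ a)) ⟩
  ∑∈ F (λ (a , d) → u (+ a) + v (+ a)) ∎
  where
  open ≡-Reasoning
  F = factorisations n
  inner : ∀ {a d} → Factorisation n (a , d) →
    + 6 * ∑∈ [1⋯ d ∸ 1 ] (λ x → e (+ a) (+ a) (+ x) (+ (d ∸ x))) ≡ u (+ d) + v (+ a)
  inner {a} {d} (0<a , 0<d , ad≡n) = begin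
    + 6 * ∑∈ [1⋯ d ∸ 1 ] (λ x → e (+ a) (+ a) (+ x) (+ (d ∸ x)))
      ≡⟨ cong (+ 6 *_) (∑∈-cong [1⋯ d ∸ 1 ] (λ {x} x∈ → trans (diagonal (+ a) (+ x) (+ (d ∸ x)))
           (cong (λ z → α (+ a) z + β (+ a) z * (+ x * + (d ∸ x)))
             (cong +_ (ℕ.m+[n∸m]≡n (ℕ.≤-trans (proj₂ (sound ([1⋯]-enumerates (d ∸ 1)) x∈)) (ℕ.m∸n≤m d 1))))))) ⟩
    + 6 * ∑∈ [1⋯ d ∸ 1 ] (λ x → α (+ a) (+ d) + β (+ a) (+ d) * (+ x * + (d ∸ x)))
      ≡⟨ 6∑-quadratic (α (+ a) (+ d)) (β (+ a) (+ d)) d 0<d ⟩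
    + 6 * α (+ a) (+ d) * (+ d - 1ℤ) + β (+ a) (+ d) * (+ d * + d * + d - + d)
      ≡⟨ separate (trans (cong +_ (sym ad≡n)) (ℤ.pos-* a d)) ⟩
    u (+ d) + v (+ a) ∎

pos-^ : ∀ a k → + (a ℕ.^ k) ≡ (+ a) ^ k
pos-^ a zero    = refl
pos-^ a (suc k) = trans (ℤ.pos-* a (a ℕ.^ k)) (cong (+ a *_) (pos-^ a k))

σ-powers : ∀ k n → + σ k n ≡ ∑∈ (factorisations n) (λ (a , d) → (+ a) ^ k)
σ-powers k n = trans (σ-factorisations k n) (∑∈-cong (factorisations n) (λ { {a , d} _ → pos-^ a k }))

-- Besge's formula for ∑ σ(m) σ(n - m), the source of σ₃ in the theorem.
convolution-1 : ∀ n → + 12 * convolution n (λ m k → 1ℤ) ≡ + 5 * + σ 3 n + (1ℤ - + 6 * + n) * + σ 1 n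
convolution-1 n = begin
  + 12 * convolution n (λ m k → 1ℤ)
    ≡⟨ ℤ.*-assoc (+ 6) (+ 2) (convolution n (λ m k → 1ℤ)) ⟩
  + 6 * (+ 2 * convolution n (λ m k → 1ℤ))
    ≡⟨ cong (+ 6 *_) (∑∈-*ˡ (+ 2) [1⋯ n ∸ 1 ] _) ⟩
  + 6 * ∑∈ [1⋯ n ∸ 1 ] (λ m → + 2 * (1ℤ * + σ 1 m * + σ 1 (n ∸ m)))
    ≡⟨ cong (+ 6 *_) (∑∈-cong [1⋯ n ∸ 1 ] (λ {m} _ → lemma (+ σ 1 m) (+ σ 1 (n ∸ m)))) ⟩
  + 6 * convolution n (λ m k → + 2)
    ≡⟨ cong (+ 6 *_) (convolution-solutions n (λ m k → + 2)) ⟩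
  + 6 * ∑∈ (solutions n) ⟪ (λ a b x y → + 2 * a * b) ⟫
    ≡⟨ 6∑-solutions n
         -- This is q(x, y) - q(a, -b) for q(x, y) = x² + x y + y², and the subtractive step
         -- exchanges the two values of q. Symmetrising cancels the squares and leaves 2 a b + 2 x
         -- y.
         (λ a b x y → x * x + x * y + y * y - a * a + a * b - b * b) (λ a b x y → + 2 * a * b)
         (λ a d → d * d - a * a) (λ a d → - 1ℤ)
         -- The mixed term a² d has become n a. The squares of d and of a cancel once the divisor
         -- sums are merged.
         (λ d → + 5 * (d * d * d) + d - + 6 * (d * d)) (λ a → + 6 * (a * a) - + 6 * + n * a)
         anti e∼p diagonal (λ { {a} {d} n≡ad → subst
           (λ z → + 6 * (d * d - a * a) * (d - 1ℤ) + - 1ℤ * (d * d * d - d)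
                ≡ + 5 * (d * d * d) + d - + 6 * (d * d) + (+ 6 * (a * a) - + 6 * z * a))
           (sym n≡ad) (separate a d) }) ⟩
  ∑∈ F (λ (a , d) → + 5 * (+ a * + a * + a) + + a - + 6 * (+ a * + a) + (+ 6 * (+ a * + a) - + 6 * + n * + a))
    ≡⟨ ∑∈-cong F (λ { {a , d} _ → recombine (+ n) (+ a) }) ⟩
  ∑∈ F (λ (a , d) → + 5 * (+ a * (+ a * (+ a * 1ℤ))) + (1ℤ - + 6 * + n) * (+ a * 1ℤ))
    ≡⟨ ∑∈-+ F (λ (a , d) → + 5 * (+ a * (+ a * (+ a * 1ℤ)))) (λ (a , d) → (1ℤ - + 6 * + n) * (+ a * 1ℤ)) ⟩
  ∑∈ F (λ (a , d) → + 5 * (+ a * (+ a * (+ a * 1ℤ)))) + ∑∈ F (λ (a , d) → (1ℤ - + 6 * + n) * (+ a * 1ℤ))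
    ≡⟨ cong₂ _+_ (sym (∑∈-*ˡ (+ 5) F (λ (a , d) → + a * (+ a * (+ a * 1ℤ)))))
                 (sym (∑∈-*ˡ (1ℤ - + 6 * + n) F (λ (a , d) → + a * 1ℤ))) ⟩
  + 5 * ∑∈ F (λ (a , d) → + a * (+ a * (+ a * 1ℤ))) + (1ℤ - + 6 * + n) * ∑∈ F (λ (a , d) → + a * 1ℤ)
    ≡⟨ cong₂ (λ s t → + 5 * s + (1ℤ - + 6 * + n) * t) (σ-powers 3 n) (σ-powers 1 n) ⟨
  + 5 * + σ 3 n + (1ℤ - + 6 * + n) * + σ 1 n ∎
  where
  open ≡-Reasoning
  F = factorisations n
  lemma : ∀ s t → + 2 * (1ℤ * s * t) ≡ + 2 * s * t
  lemma = solve-∀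
  anti : ∀ a b x y → - (x * x + x * y + y * y - a * a + a * b - b * b)
    ≡ a * a + a * (b - a) + (b - a) * (b - a) - (x + y) * (x + y) + (x + y) * y - y * y
  anti = solve-∀
  e∼p : ∀ a b x y → (x * x + x * y + y * y - a * a + a * b - b * b) + (a * a + a * b + b * b - x * x
      + x * y - y * y)
    ≡ + 2 * a * b + + 2 * x * y
  e∼p = solve-∀
  diagonal : ∀ a x y → x * x + x * y + y * y - a * a + a * a - a * a
    ≡ (x + y) * (x + y) - a * a + - 1ℤ * (x * y)
  diagonal = solve-∀
  separate : ∀ a d → + 6 * (d * d - a * a) * (d - 1ℤ) + - 1ℤ * (d * d * d - d)
    ≡ + 5 * (d * d * d) + d - + 6 * (d * d) + (+ 6 * (a * a) - + 6 * (a * d) * a)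
  separate = solve-∀
  recombine : ∀ n a → + 5 * (a * a * a) + a - + 6 * (a * a) + (+ 6 * (a * a) - + 6 * n * a)
    ≡ + 5 * (a * (a * (a * 1ℤ))) + (1ℤ - + 6 * n) * (a * 1ℤ)
  recombine = solve-∀

-- Chazy's equation as a convolution identity

chazyKernel : ℤ → ℤ → ℤ
chazyKernel m k = + 36 * (m * k) - + 12 * (m * m) - + 12 * (k * k)

open +-*-Solver using (Polynomial; solve; con; _:=_; _:+_; _:*_; _:-_; :-_)

module _ {n : ℕ} where
  private
    c : ℕ → Polynomial n
    c k = con (+ k)

  -- Copies of `chazyKernel` and `chazyForm` in the syntax of the solver: the substitutions below
  -- become plain applications, and nothing has to be expanded by hand.
  chazyKernelₚ : Polynomial n → Polynomial n → Polynomial n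
  chazyKernelₚ m k = c 36 :* (m :* k) :- c 12 :* (m :* m) :- c 12 :* (k :* k)

  chazyFormₚ : Polynomial n → Polynomial n → Polynomial n → Polynomial n → Polynomial n
  chazyFormₚ a b x y =
    (a :* a :* a :* a :* x :* x :+ b :* b :* b :* b :* y :* y
      :- c 6 :* a :* b :* (a :* a :* x :* x :+ b :* b :* y :* y)
      :- c 8 :* a :* b :* x :* y :* (a :* a :+ b :* b)
      :+ c 6 :* a :* a :* b :* b :* (x :* x :+ c 3 :* x :* y :+ y :* y))
    :- (a :* a :* x :* x :* x :* x :+ b :* b :* y :* y :* y :* y
      :+ c 6 :* x :* y :* (a :* a :* x :* x :+ b :* b :* y :* y)
      :- c 8 :* a :* b :* x :* y :* (x :* x :+ y :* y)
      :+ c 6 :* x :* x :* y :* y :* (a :* a :- c 3 :* a :* b :+ b :* b))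

-- Found by solving the hypotheses of ∑-solutions for chazyKernel as linear equations for a
-- combination of monomials of bidegree (4,2) and (2,4) in (a,b) and (x,y).
chazyForm : ℤ → ℤ → ℤ → ℤ → ℤ
chazyForm a b x y =
  (a * a * a * a * x * x + b * b * b * b * y * y
    - + 6 * a * b * (a * a * x * x + b * b * y * y)
    - + 8 * a * b * x * y * (a * a + b * b)
    + + 6 * a * a * b * b * (x * x + + 3 * x * y + y * y))
  - (a * a * x * x * x * x + b * b * y * y * y * y
    + + 6 * x * y * (a * a * x * x + b * b * y * y)
    - + 8 * a * b * x * y * (x * x + y * y)
    + + 6 * x * x * y * y * (a * a - + 3 * a * b + b * b))

-- The substitution exchanges the degrees in (a, b) and in (x, y), hence also the two halves of the
-- form, of bidegrees (4, 2) and (2, 4), which enter with opposite signs.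
chazyForm-euclid : ∀ a b x y → - chazyForm a b x y ≡ chazyForm (x + y) y a (b - a)
chazyForm-euclid = solve 4 (λ a b x y → :- chazyFormₚ a b x y := chazyFormₚ (x :+ y) y a (b :- a)) refl

chazyForm-swap : ∀ a b x y → chazyForm a b x y + chazyForm x y a b
  ≡ chazyKernel (a * x) (b * y) * a * b + chazyKernel (x * a) (y * b) * x * y
chazyForm-swap = solve 4 (λ a b x y → chazyFormₚ a b x y :+ chazyFormₚ x y a b
  := chazyKernelₚ (a :* x) (b :* y) :* a :* b :+ chazyKernelₚ (x :* a) (y :* b) :* x :* y) refl

chazyForm-diagonal : ∀ a x y → chazyForm a a x y
  ≡ a * a * a * a * ((x + y) * (x + y)) - a * a * ((x + y) * (x + y) * (x + y) * (x + y))
    + + 6 * (a * a * ((x + y) * (x + y))) * (x * y)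
chazyForm-diagonal = solve 3 (λ a x y → chazyFormₚ a a x y
  := a :* a :* a :* a :* ((x :+ y) :* (x :+ y)) :- a :* a :* ((x :+ y) :* (x :+ y) :* (x :+ y) :* (x :+ y))
    :+ con (+ 6) :* (a :* a :* ((x :+ y) :* (x :+ y))) :* (x :* y)) refl

-- This is the coefficient of qⁿ in θ³s - θ²s = 36 (θs)² - 12 (θ²s s + s θ²s). In the diagonal sum
-- the cubes of d coming from the two summands cancel, so that σ alone remains; in `convolution-1`
-- they survive as σ₃.
convolution-chazy : ∀ n → convolution n chazyKernel ≡ (+ n * + n) * (+ n - 1ℤ) * + σ 1 n
convolution-chazy n = ℤ.*-cancelˡ-≡ (+ 6) _ _ (begin
  + 6 * convolution n chazyKernel
    ≡⟨ cong (+ 6 *_) (convolution-solutions n chazyKernel) ⟩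
  + 6 * ∑∈ (solutions n) ⟪ (λ a b x y → chazyKernel (a * x) (b * y) * a * b) ⟫
    ≡⟨ 6∑-solutions n chazyForm (λ a b x y → chazyKernel (a * x) (b * y) * a * b)
         (λ a d → a * a * a * a * (d * d) - a * a * (d * d * d * d)) (λ a d → + 6 * (a * a * (d * d)))
         (λ d → + 6 * (+ n * + n) * (d * d - d)) (λ a → + 6 * (+ n * + n) * (+ n * a - a * a))
         chazyForm-euclid chazyForm-swap chazyForm-diagonal (λ { {a} {d} n≡ad → subst
           (λ z → + 6 * (a * a * a * a * (d * d) - a * a * (d * d * d * d)) * (d - 1ℤ)
                  + + 6 * (a * a * (d * d)) * (d * d * d - d)
                ≡ + 6 * (z * z) * (d * d - d) + + 6 * (z * z) * (z * a - a * a))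
           (sym n≡ad) (separate a d) }) ⟩
  ∑∈ F (λ (a , d) → + 6 * (+ n * + n) * (+ a * + a - + a) + + 6 * (+ n * + n) * (+ n * + a - + a * + a))
    ≡⟨ ∑∈-cong F (λ { {a , d} _ → recombine (+ n) (+ a) }) ⟩
  ∑∈ F (λ (a , d) → + 6 * ((+ n * + n) * (+ n - 1ℤ)) * (+ a * 1ℤ))
    ≡⟨ ∑∈-*ˡ (+ 6 * ((+ n * + n) * (+ n - 1ℤ))) F (λ (a , d) → + a * 1ℤ) ⟨
  + 6 * ((+ n * + n) * (+ n - 1ℤ)) * ∑∈ F (λ (a , d) → + a * 1ℤ)
    ≡⟨ cong (+ 6 * ((+ n * + n) * (+ n - 1ℤ)) *_) (σ-powers 1 n) ⟨
  + 6 * ((+ n * + n) * (+ n - 1ℤ)) * + σ 1 n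
    ≡⟨ ℤ.*-assoc (+ 6) ((+ n * + n) * (+ n - 1ℤ)) (+ σ 1 n) ⟩
  + 6 * ((+ n * + n) * (+ n - 1ℤ) * + σ 1 n) ∎)
  where
  open ≡-Reasoning
  F = factorisations n
  separate : ∀ a d → + 6 * (a * a * a * a * (d * d) - a * a * (d * d * d * d)) * (d - 1ℤ)
      + + 6 * (a * a * (d * d)) * (d * d * d - d)
    ≡ + 6 * ((a * d) * (a * d)) * (d * d - d) + + 6 * ((a * d) * (a * d)) * ((a * d) * a - a * a)
  separate = solve-∀
  recombine : ∀ n a → + 6 * (n * n) * (a * a - a) + + 6 * (n * n) * (n * a - a * a)
    ≡ + 6 * ((n * n) * (n - 1ℤ)) * (a * 1ℤ)
  recombine = solve-∀

-- The kernels are compared only where m + k = n. This is how powers of n in front of a convolution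
-- are absorbed into a homogeneous kernel.
convolution-cong : ∀ n {g h : ℤ → ℤ → ℤ} → (∀ m k → + n ≡ m + k → g m k ≡ h m k) → convolution n g ≡ convolution n h
convolution-cong n g≡h = ∑∈-cong [1⋯ n ∸ 1 ] λ {m} m∈ → cong (λ z → z * + σ 1 m * + σ 1 (n ∸ m))
  (g≡h (+ m) (+ (n ∸ m)) (cong +_ (sym (ℕ.m+[n∸m]≡n
    (ℕ.≤-trans (proj₂ (sound ([1⋯]-enumerates (n ∸ 1)) m∈)) (ℕ.m∸n≤m n 1))))))

convolution-linear : ∀ n c d g h →
  c * convolution n g + d * convolution n h ≡ convolution n (λ m k → c * g m k + d * h m k)
convolution-linear n c d g h = begin
  c * convolution n g + d * convolution n h
    ≡⟨ cong₂ _+_ (∑∈-*ˡ c [1⋯ n ∸ 1 ] _) (∑∈-*ˡ d [1⋯ n ∸ 1 ] _) ⟩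
  ∑∈ [1⋯ n ∸ 1 ] (λ m → c * (g (+ m) (+ (n ∸ m)) * + σ 1 m * + σ 1 (n ∸ m)))
    + ∑∈ [1⋯ n ∸ 1 ] (λ m → d * (h (+ m) (+ (n ∸ m)) * + σ 1 m * + σ 1 (n ∸ m)))
    ≡⟨ ∑∈-+ [1⋯ n ∸ 1 ] (λ m → c * (g (+ m) (+ (n ∸ m)) * + σ 1 m * + σ 1 (n ∸ m))) (λ m → d * (h (+ m) (+ (n ∸ m)) * + σ 1 m * + σ 1 (n ∸ m))) ⟨
  ∑∈ [1⋯ n ∸ 1 ] (λ m → c * (g (+ m) (+ (n ∸ m)) * + σ 1 m * + σ 1 (n ∸ m))
                       + d * (h (+ m) (+ (n ∸ m)) * + σ 1 m * + σ 1 (n ∸ m)))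
    ≡⟨ ∑∈-cong [1⋯ n ∸ 1 ] (λ {m} _ → lemma c d (g (+ m) (+ (n ∸ m))) (h (+ m) (+ (n ∸ m))) (+ σ 1 m) (+ σ 1 (n ∸ m))) ⟩
  convolution n (λ m k → c * g m k + d * h m k) ∎
  where
  open ≡-Reasoning
  lemma : ∀ c d g h s t → c * (g * s * t) + d * (h * s * t) ≡ (c * g + d * h) * s * t
  lemma = solve-∀

convolution-*ˡ : ∀ n c g → c * convolution n g ≡ convolution n (λ m k → c * g m k)
convolution-*ˡ n c g = trans (∑∈-*ˡ c [1⋯ n ∸ 1 ] _)
  (∑∈-cong [1⋯ n ∸ 1 ] (λ {m} _ → lemma c (g (+ m) (+ (n ∸ m))) (+ σ 1 m) (+ σ 1 (n ∸ m))))
  where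
  lemma : ∀ c g s t → c * (g * s * t) ≡ c * g * s * t
  lemma = solve-∀

convolution-flip : ∀ n g → convolution n g ≡ convolution n (λ m k → g k m)
convolution-flip zero      g = refl
convolution-flip n@(suc N) g = ∑∈-bijection ([1⋯]-enumerates N) ([1⋯]-enumerates N) (n ∸_) (n ∸_)
  reflects reflects involutive involutive
  (λ {m} (_ , m≤N) → trans (lemma (g (+ m) (+ (n ∸ m))) (+ σ 1 m) (+ σ 1 (n ∸ m)))
    (cong (λ z → g (+ z) (+ (n ∸ m)) * + σ 1 (n ∸ m) * + σ 1 z) (sym (ℕ.m∸[m∸n]≡n (ℕ.m≤n⇒m≤1+n m≤N)))))
  where
  lemma : ∀ c s t → c * s * t ≡ c * t * s
  lemma = solve-∀
  reflects : ∀ {m} → 0 < m × m ≤ N → 0 < n ∸ m × n ∸ m ≤ N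
  reflects {suc m} (_ , m<N) = ℕ.m<n⇒0<n∸m (s≤s m<N) , ℕ.m∸n≤m N m
  involutive : ∀ {m} → 0 < m × m ≤ N → n ∸ (n ∸ m) ≡ m
  involutive (_ , m≤N) = ℕ.m∸[m∸n]≡n (ℕ.m≤n⇒m≤1+n m≤N)

-- The convolution that represents n⁴(σ₃ - σ)

σ₃-σ₁-kernel : ℤ → ℤ → ℤ
σ₃-σ₁-kernel m k = + 72 * (m * m * k * k) + + 48 * (m * m * m * k) - + 24 * (m * m * m * m)

-- Add n⁴ times `convolution-1` and 6 n² times `convolution-chazy`: the terms n⁵ σ cancel, 5 n⁴(σ₃ -
-- σ) is left, and the kernel is homogeneous of degree 4.
n⁴σ₃-n⁴σ₁ : ∀ n → (+ n) ^ 4 * + σ 3 n ≡ (+ n) ^ 4 * + σ 1 n + convolution n σ₃-σ₁-kernel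
n⁴σ₃-n⁴σ₁ n = ℤ.*-cancelˡ-≡ (+ 5) _ _ (begin
  + 5 * (N * + σ 3 n)
    ≡⟨ lemma₁ (+ n) (+ σ 1 n) (+ σ 3 n) ⟩
  + 5 * (N * + σ 1 n) + (N * (+ 5 * + σ 3 n + (1ℤ - + 6 * + n) * + σ 1 n) + + 6 * (+ n * + n) * ((+ n * + n) * (+ n - 1ℤ) * + σ 1 n))
    ≡⟨ cong₂ (λ s t → + 5 * (N * + σ 1 n) + (N * s + + 6 * (+ n * + n) * t)) (convolution-1 n) (convolution-chazy n) ⟨
  + 5 * (N * + σ 1 n) + (N * (+ 12 * convolution n (λ _ _ → 1ℤ)) + + 6 * (+ n * + n) * convolution n chazyKernel)
    ≡⟨ cong (λ z → + 5 * (N * + σ 1 n) + z) convolutions ⟩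
  + 5 * (N * + σ 1 n) + + 5 * convolution n σ₃-σ₁-kernel
    ≡⟨ ℤ.*-distribˡ-+ (+ 5) (N * + σ 1 n) (convolution n σ₃-σ₁-kernel) ⟨
  + 5 * (N * + σ 1 n + convolution n σ₃-σ₁-kernel) ∎)
  where
  open ≡-Reasoning
  N = (+ n) ^ 4
  half : ℤ → ℤ → ℤ
  half m k = + 36 * (m * m * k * k) + + 24 * (m * m * m * k) - + 12 * (m * m * m * m)
  lemma₁ : ∀ n s t → + 5 * (n * (n * (n * (n * 1ℤ))) * t) ≡ + 5 * (n * (n * (n * (n * 1ℤ))) * s)
    + (n * (n * (n * (n * 1ℤ))) * (+ 5 * t + (1ℤ - + 6 * n) * s) + + 6 * (n * n) * ((n * n) * (n - 1ℤ) * s))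
  lemma₁ = solve-∀
  lemma₂ : ∀ m k → (m + k) * ((m + k) * ((m + k) * ((m + k) * 1ℤ))) * + 12 * 1ℤ
      + + 6 * ((m + k) * (m + k)) * (+ 36 * (m * k) - + 12 * (m * m) - + 12 * (k * k))
    ≡ + 5 * (+ 36 * (m * m * k * k) + + 24 * (m * m * m * k) - + 12 * (m * m * m * m))
    + + 5 * (+ 36 * (k * k * m * m) + + 24 * (k * k * k * m) - + 12 * (k * k * k * k))
  lemma₂ = solve-∀
  lemma₃ : ∀ m k → + 5 * (+ 36 * (m * m * k * k) + + 24 * (m * m * m * k) - + 12 * (m * m * m * m))
    + + 5 * (+ 36 * (m * m * k * k) + + 24 * (m * m * m * k) - + 12 * (m * m * m * m))
    ≡ + 5 * (+ 72 * (m * m * k * k) + + 48 * (m * m * m * k) - + 24 * (m * m * m * m))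
  lemma₃ = solve-∀
  convolutions : N * (+ 12 * convolution n (λ _ _ → 1ℤ)) + + 6 * (+ n * + n) * convolution n chazyKernel
               ≡ + 5 * convolution n σ₃-σ₁-kernel
  convolutions = begin
    N * (+ 12 * convolution n (λ _ _ → 1ℤ)) + + 6 * (+ n * + n) * convolution n chazyKernel
      ≡⟨ cong (_+ + 6 * (+ n * + n) * convolution n chazyKernel) (ℤ.*-assoc N (+ 12) (convolution n (λ _ _ → 1ℤ))) ⟨
    N * + 12 * convolution n (λ _ _ → 1ℤ) + + 6 * (+ n * + n) * convolution n chazyKernel
      ≡⟨ convolution-linear n (N * + 12) (+ 6 * (+ n * + n)) (λ _ _ → 1ℤ) chazyKernel ⟩
    convolution n (λ m k → N * + 12 * 1ℤ + + 6 * (+ n * + n) * chazyKernel m k)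
      ≡⟨ convolution-cong n (λ m k n≡m+k → trans
           (cong (λ z → z ^ 4 * + 12 * 1ℤ + + 6 * (z * z) * chazyKernel m k) n≡m+k) (lemma₂ m k)) ⟩
    -- The symmetric kernel is split into a part divisible by m² and its mirror image. Flipping the
    -- latter leaves only m⁴, m³k and m²k², the shape of the kernels in the theorem.
    convolution n (λ m k → + 5 * half m k + + 5 * half k m)
      ≡⟨ convolution-linear n (+ 5) (+ 5) half (λ m k → half k m) ⟨
    + 5 * convolution n half + + 5 * convolution n (λ m k → half k m)
      ≡⟨ cong (λ z → + 5 * convolution n half + + 5 * z) (convolution-flip n half) ⟨
    + 5 * convolution n half + + 5 * convolution n half
      ≡⟨ convolution-linear n (+ 5) (+ 5) half half ⟩
    convolution n (λ m k → + 5 * half m k + + 5 * half m k)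
      ≡⟨ convolution-cong n (λ m k _ → lemma₃ m k) ⟩
    convolution n (λ m k → + 5 * σ₃-σ₁-kernel m k)
      ≡⟨ convolution-*ˡ n (+ 5) σ₃-σ₁-kernel ⟨
    + 5 * convolution n σ₃-σ₁-kernel ∎

⊛-∑∈ : ∀ a b n → a 0 ≡ 0ℤ → b 0 ≡ 0ℤ → (a ⊛ b) n ≡ ∑∈ [1⋯ n ∸ 1 ] (λ m → a m * b (n ∸ m))
⊛-∑∈ a b zero    a₀≡0 b₀≡0 = trans (cong (λ z → z * b 0 + 0ℤ) a₀≡0) (trans (ℤ.+-identityʳ _) (ℤ.*-zeroˡ (b 0)))
⊛-∑∈ a b (suc n) a₀≡0 b₀≡0 = begin
  a 0 * b (suc n) + (tail a ⊛ b) n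
    ≡⟨ cong₂ _+_ (trans (cong (_* b (suc n)) a₀≡0) (ℤ.*-zeroˡ (b (suc n)))) (∑-Fin (suc n) suc (λ m → a m * b (suc n ∸ m))) ⟩
  0ℤ + ∑∈ [1⋯ suc n ] (λ m → a m * b (suc n ∸ m))
    ≡⟨ ℤ.+-identityˡ _ ⟩
  ∑∈ [1⋯ suc n ] (λ m → a m * b (suc n ∸ m))
    ≡⟨ ∑∈-[1⋯suc] n (λ m → a m * b (suc n ∸ m)) ⟩
  ∑∈ [1⋯ n ] (λ m → a m * b (suc n ∸ m)) + a (suc n) * b (n ∸ n)
    ≡⟨ cong (λ z → ∑∈ [1⋯ n ] (λ m → a m * b (suc n ∸ m)) + a (suc n) * z) (trans (cong b (ℕ.n∸n≡0 n)) b₀≡0) ⟩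
  ∑∈ [1⋯ n ] (λ m → a m * b (suc n ∸ m)) + a (suc n) * 0ℤ
    ≡⟨ cong (λ z → ∑∈ [1⋯ n ] (λ m → a m * b (suc n ∸ m)) + z) (ℤ.*-zeroʳ (a (suc n))) ⟩
  ∑∈ [1⋯ n ] (λ m → a m * b (suc n ∸ m)) + 0ℤ
    ≡⟨ ℤ.+-identityʳ _ ⟩
  ∑∈ [1⋯ n ] (λ m → a m * b (suc n ∸ m)) ∎
  where open ≡-Reasoning

-- The series of σ

θσ : ℕ → PowerSeries
θσ zero    = σ-series
θσ (suc i) = θ (θσ i)

θσ-^ : ∀ i n → θσ i n ≡ (+ n) ^ i * + σ 1 n
θσ-^ zero    n = sym (ℤ.*-identityˡ (+ σ 1 n))
θσ-^ (suc i) n = trans (cong (+ n *_) (θσ-^ i n)) (sym (ℤ.*-assoc (+ n) ((+ n) ^ i) (+ σ 1 n)))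

θσ-0 : ∀ i → θσ i 0 ≡ 0ℤ
θσ-0 zero    = refl
θσ-0 (suc i) = refl

θσ-⊛-θσ : ∀ i j n → (θσ i ⊛ θσ j) n ≡ convolution n (λ m k → m ^ i * k ^ j)
θσ-⊛-θσ i j n = trans (⊛-∑∈ (θσ i) (θσ j) n (θσ-0 i) (θσ-0 j)) (∑∈-cong [1⋯ n ∸ 1 ] (λ {m} _ →
  trans (cong₂ _*_ (θσ-^ i m) (θσ-^ j (n ∸ m))) (lemma ((+ m) ^ i) ((+ (n ∸ m)) ^ j) (+ σ 1 m) (+ σ 1 (n ∸ m)))))
  where
  lemma : ∀ x y s t → x * s * (y * t) ≡ x * y * s * t
  lemma = solve-∀

chazy : θσ 3 ≗ θσ 2 ⊞ const (+ 36) ⊛ (θσ 1 ⊛ θσ 1) ⊞ const (-[1+ 11 ]) ⊛ ((θσ 2 ⊛ θσ 0) ⊞ (θσ 0 ⊛ θσ 2))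
chazy n = begin
  θσ 3 n
    ≡⟨ θσ-^ 3 n ⟩
  (+ n) ^ 3 * + σ 1 n
    ≡⟨ lemma₁ (+ n) (+ σ 1 n) ⟩
  (+ n) ^ 2 * + σ 1 n + (+ n * + n) * (+ n - 1ℤ) * + σ 1 n
    ≡⟨ cong₂ _+_ (θσ-^ 2 n) (convolution-chazy n) ⟨
  θσ 2 n + convolution n chazyKernel
    ≡⟨ cong (λ z → θσ 2 n + z) (convolution-cong n (λ m k _ → lemma₂ m k)) ⟩
  θσ 2 n + convolution n (λ m k → + 36 * M 1 1 m k + -[1+ 11 ] * (1ℤ * M 2 0 m k + 1ℤ * M 0 2 m k))
    ≡⟨ cong (λ z → θσ 2 n + z) (convolution-linear n (+ 36) -[1+ 11 ] (M 1 1) (λ m k → 1ℤ * M 2 0 m k + 1ℤ * M 0 2 m k)) ⟨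
  θσ 2 n + (+ 36 * C 1 1 + -[1+ 11 ] * convolution n (λ m k → 1ℤ * M 2 0 m k + 1ℤ * M 0 2 m k))
    ≡⟨ cong (λ z → θσ 2 n + (+ 36 * C 1 1 + -[1+ 11 ] * z)) (convolution-linear n 1ℤ 1ℤ (M 2 0) (M 0 2)) ⟨
  θσ 2 n + (+ 36 * C 1 1 + -[1+ 11 ] * (1ℤ * C 2 0 + 1ℤ * C 0 2))
    ≡⟨ lemma₃ (θσ 2 n) (C 1 1) (C 2 0) (C 0 2) ⟩
  θσ 2 n + + 36 * C 1 1 + -[1+ 11 ] * (C 2 0 + C 0 2)
    ≡⟨ cong₂ (λ y z → θσ 2 n + + 36 * y + -[1+ 11 ] * z) (θσ-⊛-θσ 1 1 n) (cong₂ _+_ (θσ-⊛-θσ 2 0 n) (θσ-⊛-θσ 0 2 n)) ⟨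
  θσ 2 n + + 36 * (θσ 1 ⊛ θσ 1) n + -[1+ 11 ] * ((θσ 2 ⊛ θσ 0) ⊞ (θσ 0 ⊛ θσ 2)) n
    ≡⟨ cong₂ (λ y z → θσ 2 n + y + z) (const-⊛ (+ 36) (θσ 1 ⊛ θσ 1) n) (const-⊛ -[1+ 11 ] ((θσ 2 ⊛ θσ 0) ⊞ (θσ 0 ⊛ θσ 2)) n) ⟨
  θσ 2 n + (const (+ 36) ⊛ (θσ 1 ⊛ θσ 1)) n + (const -[1+ 11 ] ⊛ ((θσ 2 ⊛ θσ 0) ⊞ (θσ 0 ⊛ θσ 2))) n ∎
  where
  open ≡-Reasoning
  M : ℕ → ℕ → ℤ → ℤ → ℤ
  M i j m k = m ^ i * k ^ j
  C : ℕ → ℕ → ℤ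
  C i j = convolution n (M i j)
  lemma₁ : ∀ n s → n * (n * (n * 1ℤ)) * s ≡ n * (n * 1ℤ) * s + (n * n) * (n - 1ℤ) * s
  lemma₁ = solve-∀
  lemma₂ : ∀ m k → + 36 * (m * k) - + 12 * (m * m) - + 12 * (k * k)
    ≡ + 36 * (m * 1ℤ * (k * 1ℤ)) + -[1+ 11 ] * (1ℤ * (m * (m * 1ℤ) * 1ℤ) + 1ℤ * (1ℤ * (k * (k * 1ℤ))))
  lemma₂ = solve-∀
  lemma₃ : ∀ w x y z → w + (+ 36 * x + -[1+ 11 ] * (1ℤ * y + 1ℤ * z)) ≡ w + + 36 * x + -[1+ 11 ] * (y + z)
  lemma₃ = solve-∀

open ChazyEquation powerSeries using (eisenstein₂; cuspForm; θ-cuspForm)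

τ≗cuspForm : τ ≗ cuspForm σ-series
-- Each `refl` evaluates closed terms: P has constant term 1, and both series begin with 0 + q.
τ≗cuspForm = θ≗p⊛-unique {eisenstein₂ σ-series} refl θτ (θ-cuspForm σ-series chazy) refl refl


-- The four identities

∑-from-1-convolution : ∀ n (f : ℤ → ℤ) g → (∀ m k → + n ≡ m + k → f m ≡ g m k) →
  ∑[1≤ m < n ] (f (+ m) * + σ 1 m * + σ 1 (n ∸ m)) ≡ convolution n g
∑-from-1-convolution n f g f≡g = trans (∑-Fin (n ∸ 1) suc (λ m → f (+ m) * + σ 1 m * + σ 1 (n ∸ m)))
  (convolution-cong n {λ m _ → f m} f≡g)

τ-kernel : ℤ → ℤ → ℤ
τ-kernel m k = m * m * m * m + -[1+ 15 ] * (m * m * m * k) + + 18 * (m * m * k * k)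

τ-convolution : ∀ n → τ n ≡ (+ n) ^ 4 * + σ 1 n - + 24 * convolution n τ-kernel
τ-convolution n = begin
  τ n
    ≡⟨ τ≗cuspForm n ⟩
  θσ 4 n + (const -[1+ 23 ] ⊛ (θσ 4 ⊛ θσ 0 ⊞ const -[1+ 15 ] ⊛ (θσ 3 ⊛ θσ 1) ⊞ const (+ 18) ⊛ (θσ 2 ⊛ θσ 2))) n
    ≡⟨ cong₂ _+_ (θσ-^ 4 n) (const-⊛ -[1+ 23 ] (θσ 4 ⊛ θσ 0 ⊞ const -[1+ 15 ] ⊛ (θσ 3 ⊛ θσ 1) ⊞ const (+ 18) ⊛ (θσ 2 ⊛ θσ 2)) n) ⟩
  N + -[1+ 23 ] * ((θσ 4 ⊛ θσ 0) n + (const -[1+ 15 ] ⊛ (θσ 3 ⊛ θσ 1)) n + (const (+ 18) ⊛ (θσ 2 ⊛ θσ 2)) n)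
    ≡⟨ cong₂ (λ y z → N + -[1+ 23 ] * ((θσ 4 ⊛ θσ 0) n + y + z))
         (const-⊛ -[1+ 15 ] (θσ 3 ⊛ θσ 1) n) (const-⊛ (+ 18) (θσ 2 ⊛ θσ 2) n) ⟩
  N + -[1+ 23 ] * ((θσ 4 ⊛ θσ 0) n + -[1+ 15 ] * (θσ 3 ⊛ θσ 1) n + + 18 * (θσ 2 ⊛ θσ 2) n)
    ≡⟨ cong₂ (λ x z → N + -[1+ 23 ] * (x + z)) (cong₂ (λ x y → x + -[1+ 15 ] * y) (θσ-⊛-θσ 4 0 n) (θσ-⊛-θσ 3 1 n))
         (cong (+ 18 *_) (θσ-⊛-θσ 2 2 n)) ⟩
  N + -[1+ 23 ] * (C 4 0 + -[1+ 15 ] * C 3 1 + + 18 * C 2 2)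
    ≡⟨ lemma₁ N (C 4 0) (C 3 1) (C 2 2) ⟩
  N - + 24 * (1ℤ * (1ℤ * C 4 0 + -[1+ 15 ] * C 3 1) + + 18 * C 2 2)
    ≡⟨ cong (λ z → N - + 24 * (1ℤ * z + + 18 * C 2 2)) (convolution-linear n 1ℤ -[1+ 15 ] (M 4 0) (M 3 1)) ⟩
  N - + 24 * (1ℤ * convolution n (λ m k → 1ℤ * M 4 0 m k + -[1+ 15 ] * M 3 1 m k) + + 18 * C 2 2)
    ≡⟨ cong (λ z → N - + 24 * z) (convolution-linear n 1ℤ (+ 18) (λ m k → 1ℤ * M 4 0 m k + -[1+ 15 ] * M 3 1 m k) (M 2 2)) ⟩
  N - + 24 * convolution n (λ m k → 1ℤ * (1ℤ * M 4 0 m k + -[1+ 15 ] * M 3 1 m k) + + 18 * M 2 2 m k)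
    ≡⟨ cong (λ z → N - + 24 * z) (convolution-cong n (λ m k _ → trans
         (lemma₂ (M 4 0 m k) (M 3 1 m k) (M 2 2 m k))
         (cong₂ _+_ (cong₂ (λ x y → x + -[1+ 15 ] * y) (M₄₀ m k) (M₃₁ m k)) (cong (+ 18 *_) (M₂₂ m k))))) ⟩
  N - + 24 * convolution n τ-kernel ∎
  where
  open ≡-Reasoning
  N = (+ n) ^ 4 * + σ 1 n
  M : ℕ → ℕ → ℤ → ℤ → ℤ
  M i j m k = m ^ i * k ^ j
  C : ℕ → ℕ → ℤ
  C i j = convolution n (M i j)
  lemma₁ : ∀ w x y z → w + -[1+ 23 ] * (x + -[1+ 15 ] * y + + 18 * z)
    ≡ w - + 24 * (1ℤ * (1ℤ * x + -[1+ 15 ] * y) + + 18 * z)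
  lemma₁ = solve-∀
  lemma₂ : ∀ x y z → 1ℤ * (1ℤ * x + -[1+ 15 ] * y) + + 18 * z ≡ x + -[1+ 15 ] * y + + 18 * z
  lemma₂ = solve-∀
  M₄₀ : ∀ m k → m * (m * (m * (m * 1ℤ))) * 1ℤ ≡ m * m * m * m
  M₄₀ = solve-∀
  M₃₁ : ∀ m k → m * (m * (m * 1ℤ)) * (k * 1ℤ) ≡ m * m * m * k
  M₃₁ = solve-∀
  M₂₂ : ∀ m k → m * (m * 1ℤ) * (k * (k * 1ℤ)) ≡ m * m * k * k
  M₂₂ = solve-∀

-- (i)–(iv) differ from one another by multiples of n⁴σ₃-n⁴σ₁ only.
τ-combination : ∀ n c d g → (∀ m k → + 24 * (m * m * m * m + -[1+ 15 ] * (m * m * m * k)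
    + + 18 * (m * m * k * k)) * c + d * (+ 72 * (m * m * k * k) + + 48 * (m * m * m * k)
    - + 24 * (m * m * m * m)) ≡ g m k) →
  c * τ n ≡ (+ n) ^ 4 * ((c - d) * + σ 1 n + d * + σ 3 n) - convolution n g
τ-combination n c d g kernels = begin
  c * τ n
    ≡⟨ cong (c *_) (τ-convolution n) ⟩
  c * (N * + σ 1 n - + 24 * T)
    ≡⟨ lemma₁ c d N (+ σ 1 n) T R ⟩
  N * ((c - d) * + σ 1 n) + d * (N * + σ 1 n + R) - (+ 24 * c * T + d * R)
    ≡⟨ cong₂ (λ y z → N * ((c - d) * + σ 1 n) + d * y - z) (sym (n⁴σ₃-n⁴σ₁ n)) (convolution-linear n (+ 24 * c) d τ-kernel σ₃-σ₁-kernel) ⟩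
  N * ((c - d) * + σ 1 n) + d * (N * + σ 3 n) - convolution n (λ m k → + 24 * c * τ-kernel m k + d * σ₃-σ₁-kernel m k)
    ≡⟨ cong₂ _-_ (lemma₂ c d N (+ σ 1 n) (+ σ 3 n))
         (convolution-cong n (λ m k _ → trans (lemma₃ c d (τ-kernel m k) (σ₃-σ₁-kernel m k)) (kernels m k))) ⟩
  N * ((c - d) * + σ 1 n + d * + σ 3 n) - convolution n g ∎
  where
  open ≡-Reasoning
  N = (+ n) ^ 4
  T = convolution n τ-kernel
  R = convolution n σ₃-σ₁-kernel
  lemma₁ : ∀ c d N s T R → c * (N * s - + 24 * T) ≡ N * ((c - d) * s) + d * (N * s + R) - (+ 24 * c * T + d * R)
  lemma₁ = solve-∀
  lemma₂ : ∀ c d N s t → N * ((c - d) * s) + d * (N * t) ≡ N * ((c - d) * s + d * t)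
  lemma₂ = solve-∀
  lemma₃ : ∀ c d x y → + 24 * c * x + d * y ≡ + 24 * x * c + d * y
  lemma₃ = solve-∀

pow₂ : ∀ m → m ^ 2 ≡ m * m
pow₂ m = cong (m *_) (ℤ.*-identityʳ m)

pow₃ : ∀ m → m ^ 3 ≡ m * m * m
pow₃ m = trans (cong (m *_) (pow₂ m)) (sym (ℤ.*-assoc m m m))

pow₄ : ∀ m → m ^ 4 ≡ m * m * m * m
pow₄ m = trans (cong (m *_) (pow₃ m)) (trans (sym (ℤ.*-assoc m (m * m) m)) (cong (_* m) (sym (ℤ.*-assoc m m m))))

-- The arguments stand for n, m⁴, m³, m² and n².
Weight : Set
Weight = ℤ → ℤ → ℤ → ℤ → ℤ → ℤ

∑-weighted : ℕ → Weight → ℤ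
∑-weighted n f = ∑[1≤ m < n ] (f (+ n) ((+ m) ^ 4) ((+ m) ^ 3) ((+ m) ^ 2) ((+ n) ^ 2) * + σ 1 m * + σ 1 (n ∸ m))

-- Since the powers are arguments of `f`, the same weight serves twice: on `_^_`, as in the theorem,
-- and on plain products, for which the kernel identities are proved by the solver.
τ-weighted : ∀ n c d e (f : Weight) →
  (∀ m k → + 24 * (m * m * m * m + -[1+ 15 ] * (m * m * m * k) + + 18 * (m * m * k * k)) * c
      + d * (+ 72 * (m * m * k * k) + + 48 * (m * m * m * k) - + 24 * (m * m * m * m))
         ≡ e * f (m + k) (m * m * m * m) (m * m * m) (m * m) ((m + k) * (m + k))) →
  c * τ n ≡ (+ n) ^ 4 * ((c - d) * + σ 1 n + d * + σ 3 n) - e * ∑-weighted n f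
τ-weighted n c d e f kernels = trans (τ-combination n c d (λ m k → e * g (m + k) m) kernels)
  (cong (λ z → (+ n) ^ 4 * ((c - d) * + σ 1 n + d * + σ 3 n) - z) (trans
    (sym (convolution-*ˡ n e (λ m k → g (m + k) m)))
    (cong (e *_) (sym (∑-from-1-convolution n (λ m → f (+ n) (m ^ 4) (m ^ 3) (m ^ 2) ((+ n) ^ 2)) (λ m k → g (m + k) m)
      (λ m k n≡m+k → trans (powers (+ n) m) (cong (λ z → g z m) n≡m+k)))))))
  where
  g : ℤ → ℤ → ℤ
  g n m = f n (m * m * m * m) (m * m * m) (m * m) (n * n)
  powers : ∀ n m → f n (m ^ 4) (m ^ 3) (m ^ 2) (n ^ 2) ≡ g n m
  powers n m = trans (cong₂ (λ p q → f n p q (m ^ 2) (n ^ 2)) (pow₄ m) (pow₃ m))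
                     (cong₂ (λ r t → f n (m * m * m * m) (m * m * m) r t) (pow₂ m) (pow₂ n))

-- On ℚ the operation `_/_` reduces to lowest terms and does not compute on variables. For
-- unnormalised fractions equality is cross multiplication, which turns the claim into the integer
-- hypothesis.
/-clear-denominator : ∀ t N X Y → + 3 * t ≡ N * X - + 3 * Y → t / 1 ≡ (N / 3) ℚ.* (X / 1) ℚ.- Y / 1
/-clear-denominator t N X Y eq = ℚ.toℚᵘ-injective (begin
  toℚᵘ (t / 1)                                            ≈⟨ ℚ.toℚᵘ-fromℚᵘ (mkℚᵘ t 0) ⟩
  mkℚᵘ t 0                                                ≈⟨ *≡* (trans (lemma₁ t) (trans eq (lemma₂ N X Y))) ⟩
  mkℚᵘ N 2 ℚᵘ.* mkℚᵘ X 0 ℚᵘ.- mkℚᵘ Y 0                    ≈⟨ ℚᵘ.+-cong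
    (ℚᵘ.*-cong (ℚ.toℚᵘ-fromℚᵘ (mkℚᵘ N 2)) (ℚ.toℚᵘ-fromℚᵘ (mkℚᵘ X 0))) (ℚᵘ.-‿cong (ℚ.toℚᵘ-fromℚᵘ (mkℚᵘ Y 0))) ⟨
  toℚᵘ (N / 3) ℚᵘ.* toℚᵘ (X / 1) ℚᵘ.- toℚᵘ (Y / 1)        ≈⟨ ℚᵘ.+-cong (ℚ.toℚᵘ-homo-* (N / 3) (X / 1)) (ℚ.toℚᵘ-homo‿- (Y / 1)) ⟨
  toℚᵘ ((N / 3) ℚ.* (X / 1)) ℚᵘ.+ toℚᵘ (ℚ.- (Y / 1))      ≈⟨ ℚ.toℚᵘ-homo-+ ((N / 3) ℚ.* (X / 1)) (ℚ.- (Y / 1)) ⟨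
  toℚᵘ ((N / 3) ℚ.* (X / 1) ℚ.- Y / 1)                    ∎)
  where
  open ℚᵘ.≃-Reasoning
  lemma₁ : ∀ t → t * + 3 ≡ + 3 * t
  lemma₁ = solve-∀
  lemma₂ : ∀ N X Y → N * X - + 3 * Y ≡ (N * X * 1ℤ + - Y * + 3) * 1ℤ
  lemma₂ = solve-∀

kernel₁ : ∀ m k → + 24 * (m * m * m * m + -[1+ 15 ] * (m * m * m * k) + + 18 * (m * m * k * k)) * 1ℤ
    + 0ℤ * (+ 72 * (m * m * k * k) + + 48 * (m * m * m * k) - + 24 * (m * m * m * m))
  ≡ + 24 * (+ 35 * (m * m * m * m) - + 52 * (m * m * m) * (m + k) + + 18 * (m * m) * ((m + k) * (m + k)))
kernel₁ = solve-∀

-- After k = n - m the coefficient of m² n² is 432 + 72 d, and d = -6 makes it vanish.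
kernel₂ : ∀ m k → + 24 * (m * m * m * m + -[1+ 15 ] * (m * m * m * k) + + 18 * (m * m * k * k)) * 1ℤ
    + -[1+ 5 ] * (+ 72 * (m * m * k * k) + + 48 * (m * m * m * k) - + 24 * (m * m * m * m))
  ≡ + 168 * (+ 5 * (m * m * m * m) - + 4 * (m * m * m) * (m + k))
kernel₂ = solve-∀

-- The choice d = c = 1 removes σ(n), whose coefficient is c - d.
kernel₃ : ∀ m k → + 24 * (m * m * m * m + -[1+ 15 ] * (m * m * m * k) + + 18 * (m * m * k * k)) * 1ℤ
    + 1ℤ * (+ 72 * (m * m * k * k) + + 48 * (m * m * m * k) - + 24 * (m * m * m * m))
  ≡ + 168 * (+ 5 * (m * m * m * m) - + 8 * (m * m * m) * (m + k) + + 3 * (m * m) * ((m + k) * (m + k)))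
kernel₃ = solve-∀

-- The factor c = 3 clears the denominator of (iv), d = -4 gives the coefficients 7 and -4, and 168
-- = 3 · 56. In m and k the kernel is 168 (m⁴ - 8 m³k + 6 m²k²).
kernel₄ : ∀ m k → + 24 * (m * m * m * m + -[1+ 15 ] * (m * m * m * k) + + 18 * (m * m * k * k)) * + 3
    + -[1+ 3 ] * (+ 72 * (m * m * k * k) + + 48 * (m * m * m * k) - + 24 * (m * m * m * m))
  ≡ + 168 * (+ 15 * (m * m * m * m) - + 20 * (m * m * m) * (m + k) + + 6 * (m * m) * ((m + k) * (m + k)))
kernel₄ = solve-∀

theorem2p5 : (n : ℕ) → 1 ≤ n →
    (τ n ≡ (+ n) ^ 4 * + σ 1 n
    - + 24 * ∑[1≤ m < n ] ((+ 35 * (+ m) ^ 4 - + 52 * (+ m) ^ 3 * + n + + 18 * (+ m) ^ 2 * (+ n) ^ 2)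
    * + σ 1 m * + σ 1 (n ∸ m)))
    × (τ n ≡ (+ n) ^ 4 * (+ 7 * + σ 1 n - + 6 * + σ 3 n)
    - + 168 * ∑[1≤ m < n ] ((+ 5 * (+ m) ^ 4 - + 4 * (+ m) ^ 3 * + n)
    * + σ 1 m * + σ 1 (n ∸ m)))
    × (τ n ≡ (+ n) ^ 4 * + σ 3 n
    - + 168 * ∑[1≤ m < n ] ((+ 5 * (+ m) ^ 4 - + 8 * (+ m) ^ 3 * + n + + 3 * (+ m) ^ 2 * (+ n) ^ 2)
    * + σ 1 m * + σ 1 (n ∸ m)))
    × (τ n / 1 ≡ ((+ n) ^ 4 / 3) ℚ.* ((+ 7 * + σ 1 n - + 4 * + σ 3 n) / 1)
    ℚ.- (+ 56 * ∑[1≤ m < n ] ((+ 15 * (+ m) ^ 4 - + 20 * (+ m) ^ 3 * + n + + 6 * (+ m) ^ 2 * (+ n) ^ 2)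
    * + σ 1 m * + σ 1 (n ∸ m))) / 1)
theorem2p5 n _ = identity₁ , identity₂ , identity₃ , identity₄
  where
  N = (+ n) ^ 4
  s = + σ 1 n
  t = + σ 3 n

  f₁ f₂ f₃ f₄ : Weight
  f₁ n m⁴ m³ m² n² = + 35 * m⁴ - + 52 * m³ * n + + 18 * m² * n²
  f₂ n m⁴ m³ m² n² = + 5 * m⁴ - + 4 * m³ * n
  f₃ n m⁴ m³ m² n² = + 5 * m⁴ - + 8 * m³ * n + + 3 * m² * n²
  f₄ n m⁴ m³ m² n² = + 15 * m⁴ - + 20 * m³ * n + + 6 * m² * n²

  identity₁ : τ n ≡ N * s - + 24 * ∑-weighted n f₁
  identity₁ = trans (sym (ℤ.*-identityˡ (τ n))) (trans (τ-weighted n 1ℤ 0ℤ (+ 24) f₁ kernel₁) (lemma N s t (∑-weighted n f₁)))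
    where
    lemma : ∀ N s t S → N * ((1ℤ - 0ℤ) * s + 0ℤ * t) - + 24 * S ≡ N * s - + 24 * S
    lemma = solve-∀

  identity₂ : τ n ≡ N * (+ 7 * s - + 6 * t) - + 168 * ∑-weighted n f₂
  identity₂ = trans (sym (ℤ.*-identityˡ (τ n))) (trans (τ-weighted n 1ℤ -[1+ 5 ] (+ 168) f₂ kernel₂) (lemma N s t (∑-weighted n f₂)))
    where
    lemma : ∀ N s t S → N * ((1ℤ - -[1+ 5 ]) * s + -[1+ 5 ] * t) - + 168 * S ≡ N * (+ 7 * s - + 6 * t) - + 168 * S
    lemma = solve-∀

  identity₃ : τ n ≡ N * t - + 168 * ∑-weighted n f₃
  identity₃ = trans (sym (ℤ.*-identityˡ (τ n))) (trans (τ-weighted n 1ℤ 1ℤ (+ 168) f₃ kernel₃) (lemma N s t (∑-weighted n f₃)))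
    where
    lemma : ∀ N s t S → N * ((1ℤ - 1ℤ) * s + 1ℤ * t) - + 168 * S ≡ N * t - + 168 * S
    lemma = solve-∀

  identity₄ : τ n / 1 ≡ (N / 3) ℚ.* ((+ 7 * s - + 4 * t) / 1) ℚ.- (+ 56 * ∑-weighted n f₄) / 1
  identity₄ = /-clear-denominator (τ n) N (+ 7 * s - + 4 * t) (+ 56 * ∑-weighted n f₄)
    (trans (τ-weighted n (+ 3) -[1+ 3 ] (+ 168) f₄ kernel₄) (lemma N s t (∑-weighted n f₄)))
    where
    lemma : ∀ N s t S → N * ((+ 3 - -[1+ 3 ]) * s + -[1+ 3 ] * t) - + 168 * S ≡ N * (+ 7 * s - + 4 * t) - + 3 * (+ 56 * S)
    lemma = solve-∀
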